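{- Let $\approx$ be an equinumerosity on $\mathbb W$, let $\mathfrak N=\mathbb W/\approx$ and let $\mathfrak n:\mathbb W\to\mathfrak N$ be the canonical map. Then there exist unique binary operations $+$ and $\cdot$ on $\mathfrak N$ and a unique linear order $<$ on $\mathfrak N$ such that for all $X,Y\in\mathbb W$: (1) $\mathfrak n(X)+\mathfrak n(Y)=\mathfrak n(X\cup Y)$ whenever $X\cap Y=\emptyset$; (2) $\mathfrak n(X)\cdot\mathfrak n(Y)=\mathfrak n(X\times Y)$ whenever $X,Y$ are multipliable; (3) $\mathfrak n(X)<\mathfrak n(Y)$ if and only if $Y\approx Y'$ for some proper superset $Y'\in\mathbb W$ of $X$. The resulting structure on $\mathfrak N$ is the non-negative part of a discretely ordered ring $(\mathfrak R,0,1,+,\cdot,<)$. Moreover, if the prime subring of $\mathfrak R$ (generated by $1$) is identified with $\mathbb Z$, then $\mathfrak n(X)=|X|$ for every finite $X\in\mathbb W$.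
   Context: Let $\mathbb N=\{0,1,2,\dots\}$. Let $\mathbb{W}$ be the family of finitary point sets: sets $A\subseteq\bigcup_{k\ge1}\mathbb N^k$ of finite tuples of natural numbers (tuples of different lengths allowed) such that for every $n\in\mathbb N$ there is $h$ with $A\cap\{0,\dots,n\}^k=\emptyset$ for all $k>h$. Cartesian products are identified with concatenations: $A\times B=\{(a_1,\dots,a_k,b_1,\dots,b_h):(a_1,\dots,a_k)\in A,\ (b_1,\dots,b_h)\in B\}$; $\{n\}$ denotes the set whose only element is the 1-tuple $(n)$. $A,B\in\mathbb W$ are multipliable if distinct pairs $(a,b)\in A\times B$ have distinct concatenations. Given an equivalence relation $\approx$ on $\mathbb W$, write $A\succ B$, equivalently $B\prec A$, if there exist $A',B'\in\mathbb W$ with $B'\subsetneq A'$, $A\approx A'$ and $B\approx B'$. An equinumerosity is an equivalence relation $\approx$ on $\mathbb W$ such that for all $A,B\in\mathbb W$: (AP) $A\approx B$ iff $A\setminus B\approx B\setminus A$; (ZP) exactly one of $A\approx B$, $A\succ B$, $A\prec B$ holds; (TP) if $T$ is injective on $A$ and $T(a)$ is a permutation of the coordinates of $a$ for every $a\in A$, then $A\approx T[A]$; (UP) $A\times\{n\}\approx A$ for all $n\in\mathbb N$; (PP) if $A,B$ are multipliable, $A',B'$ are multipliable, $A\approx A'$ and $B\approx B'$, then $A\times B\approx A'\times B'$. -}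

module Defs where

open import Algebra.Bundles using (CommutativeRing)
open import Algebra.Core using (Op₂)
open import Algebra.Definitions using (Congruent₂)
open import Algebra.Morphism.Structures using (module RingMorphisms)
open import Data.Integer.Base using (ℤ; +_; +-*-rawRing)
import Data.List.Base as List
open import Data.List.Membership.Propositional using () renaming (_∈_ to _∈ˡ_)
open import Data.List.NonEmpty.Base using (List⁺; [_]; length; toList; _⁺++⁺_)
open import Data.List.Properties using (length-++)
open import Data.List.Relation.Binary.Permutation.Propositional using (_↭_)
open import Data.List.Relation.Binary.Permutation.Propositional.Properties
  using (All-resp-↭; ↭-length)
open import Data.List.Relation.Unary.All using (All)
open import Data.List.Relation.Unary.All.Properties using (++⁻)
open import Data.List.Relation.Unary.Unique.Propositional using (Unique)
open import Data.Nat.Base using (ℕ; _≤_; _>_; _+_; _⊔_)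
open import Data.Nat.Properties
  using (m≤m⊔n; m≤n⊔m; ≤-<-trans; <-irrefl; +-mono-≤; ≮⇒≥)
open import Data.Product using (∃-syntax; _×_; _,_; proj₁; proj₂)
open import Data.Sum using (_⊎_; inj₁; inj₂)
open import Function.Bundles using (_⇔_)
open import Level using (Level; 0ℓ) renaming (suc to lsuc; _⊔_ to _⊔ˡ_)
open import Relation.Binary.Core using (Rel)
open import Relation.Binary.Definitions using (Trichotomous)
open import Relation.Binary.Morphism.Structures using (IsOrderMonomorphism)
open import Relation.Binary.PropositionalEquality
  using (_≡_; _≢_; refl; sym; trans)
open import Relation.Binary.Structures using (IsEquivalence; IsStrictTotalOrder)
open import Relation.Nullary using (¬_)
open import Relation.Unary
  using (Pred; _∈_; _⊂_; _≐_; _∪_; _∩_; _∖_; ｛_｝; Empty)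

Tuple : Set
Tuple = List⁺ ℕ

-- {0,…,n}^k
Box : ℕ → ℕ → Pred Tuple 0ℓ
Box n k a = length a ≡ k × All (_≤ n) (toList a)

Finitary : Pred Tuple 0ℓ → Set
Finitary A = ∀ n → ∃[ h ] (∀ k → k > h → Empty (A ∩ Box n k))

-- Point sets are arbitrary predicates (no decidability); two of them are the
-- same set when they are extensionally equal, `points A ≐ points B`.
record 𝕎 : Set₁ where
  constructor mk𝕎
  field
    points   : Pred Tuple 0ℓ
    finitary : Finitary points

open 𝕎 public

infixl 7 _⊗_ _×ʷ_
infixl 6 _∪ʷ_ _∖ʷ_

_∪ʷ_ : Op₂ 𝕎
mk𝕎 A fA ∪ʷ mk𝕎 B fB = mk𝕎 (A ∪ B) λ n →
  proj₁ (fA n) ⊔ proj₁ (fB n) , λ where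
    k k> a (inj₁ a∈A , a∈□) →
      proj₂ (fA n) k (≤-<-trans (m≤m⊔n _ _) k>) a (a∈A , a∈□)
    k k> a (inj₂ a∈B , a∈□) →
      proj₂ (fB n) k (≤-<-trans (m≤n⊔m (proj₁ (fA n)) _) k>) a (a∈B , a∈□)

_∖ʷ_ : Op₂ 𝕎
mk𝕎 A fA ∖ʷ mk𝕎 B _ = mk𝕎 (A ∖ B) λ n →
  proj₁ (fA n) , λ { k k> a ((a∈A , _) , a∈□) → proj₂ (fA n) k k> a (a∈A , a∈□) }

-- The Cartesian product, identified with the set of concatenations.
_⊗_ : Pred Tuple 0ℓ → Pred Tuple 0ℓ → Pred Tuple 0ℓ
(A ⊗ B) c = ∃[ a ] ∃[ b ] (a ∈ A × b ∈ B × a ⁺++⁺ b ≡ c)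

_×ʷ_ : Op₂ 𝕎
mk𝕎 A fA ×ʷ mk𝕎 B fB = mk𝕎 (A ⊗ B) λ n →
  proj₁ (fA n) + proj₁ (fB n) , λ where
    k k> _ ((a , b , a∈A , b∈B , refl) , refl , all≤) →
      let all≤a , all≤b = ++⁻ (toList a) all≤
          |a|≤ = ≮⇒≥ λ lt → proj₂ (fA n) (length a) lt a (a∈A , refl , all≤a)
          |b|≤ = ≮⇒≥ λ lt → proj₂ (fB n) (length b) lt b (b∈B , refl , all≤b)
          |ab| = length-++ (toList a) {toList b}
      in <-irrefl (sym |ab|) (≤-<-trans (+-mono-≤ |a|≤ |b|≤) k>)

-- {n}, the set whose only element is the 1-tuple (n)
⟨_⟩ : ℕ → 𝕎
⟨ n ⟩ = mk𝕎 ｛ [ n ] ｝ λ _ → 1 , λ { _ k> _ (refl , refl , _) → <-irrefl refl k> }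

PermutesCoordinatesOn : Pred Tuple 0ℓ → (Tuple → Tuple) → Set
PermutesCoordinatesOn A T = ∀ {a} → a ∈ A → toList (T a) ↭ toList a

InjectiveOn : Pred Tuple 0ℓ → (Tuple → Tuple) → Set
InjectiveOn A T = ∀ {a b} → a ∈ A → b ∈ A → T a ≡ T b → a ≡ b

image : (T : Tuple → Tuple) (A : 𝕎) → PermutesCoordinatesOn (points A) T → 𝕎
image T (mk𝕎 A fA) perm = mk𝕎 (λ b → ∃[ a ] (a ∈ A × T a ≡ b)) λ n →
  proj₁ (fA n) , λ where
    k k> _ ((a , a∈A , refl) , |Ta|≡k , all≤) →
      proj₂ (fA n) k k> a
        (a∈A , trans (sym (↭-length (perm a∈A))) |Ta|≡k , All-resp-↭ (perm a∈A) all≤)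

Multipliable : Rel 𝕎 0ℓ
Multipliable A B = ∀ {a a′ b b′} →
  a ∈ points A → a′ ∈ points A → b ∈ points B → b′ ∈ points B →
  (a , b) ≢ (a′ , b′) → a ⁺++⁺ b ≢ a′ ⁺++⁺ b′

module _ {ℓ : Level} (_≈_ : Rel 𝕎 ℓ) where

  infix 4 _≺_

  _≺_ : Rel 𝕎 (lsuc 0ℓ ⊔ˡ ℓ)
  B ≺ A = ∃[ A′ ] ∃[ B′ ] (points B′ ⊂ points A′ × A ≈ A′ × B ≈ B′)

  record IsEquinumerosity : Set (lsuc 0ℓ ⊔ˡ ℓ) where
    field
      isEquivalence : IsEquivalence _≈_
      -- Implicit in set theory, where extensionally equal sets are identical.
      extensional   : ∀ {A B} → points A ≐ points B → A ≈ B
      AP            : ∀ A B → A ≈ B ⇔ (A ∖ʷ B) ≈ (B ∖ʷ A)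
      ZP            : Trichotomous _≈_ _≺_
      TP            : ∀ A T (perm : PermutesCoordinatesOn (points A) T) →
                      InjectiveOn (points A) T → A ≈ image T A perm
      UP            : ∀ A n → (A ×ʷ ⟨ n ⟩) ≈ A
      PP            : ∀ {A B A′ B′} → Multipliable A B → Multipliable A′ B′ →
                      A ≈ A′ → B ≈ B′ → (A ×ʷ B) ≈ (A′ ×ʷ B′)

  -- The quotient 𝔑 = 𝕎/≈ is the setoid (𝕎 , ≈), and the canonical map
  -- 𝔫 : 𝕎 → 𝔑 is the identity on carriers.  An operation or relation on 𝔑
  -- is one on 𝕎 that respects ≈, and equality in 𝔑 is ≈.

  record IsAddition (_⊕_ : Op₂ 𝕎) : Set (lsuc 0ℓ ⊔ˡ ℓ) where
    field
      congruent : Congruent₂ _≈_ _⊕_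
      union     : ∀ X Y → Empty (points X ∩ points Y) → (X ⊕ Y) ≈ (X ∪ʷ Y)

  record IsMultiplication (_⊙_ : Op₂ 𝕎) : Set (lsuc 0ℓ ⊔ˡ ℓ) where
    field
      congruent : Congruent₂ _≈_ _⊙_
      product   : ∀ X Y → Multipliable X Y → (X ⊙ Y) ≈ (X ×ʷ Y)

  -- `IsStrictTotalOrder` includes that ◁ respects ≈.
  record IsOrdering {ℓ′ : Level} (_◁_ : Rel 𝕎 ℓ′) : Set (lsuc 0ℓ ⊔ˡ ℓ ⊔ˡ ℓ′) where
    field
      isStrictTotalOrder : IsStrictTotalOrder _≈_ _◁_
      superset           : ∀ X Y → X ◁ Y ⇔ (∃[ Y′ ] (points X ⊂ points Y′ × Y ≈ Y′))

-- A commutative ordered ring in which 1 is the least positive element.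
record DiscretelyOrderedRing (c ℓ₁ ℓ₂ : Level) : Set (lsuc (c ⊔ˡ ℓ₁ ⊔ˡ ℓ₂)) where
  infix 4 _⊏_
  field
    commutativeRing : CommutativeRing c ℓ₁

  open CommutativeRing commutativeRing public
    renaming (_+_ to _⊕_; _*_ to _⊙_)

  field
    _⊏_                : Rel Carrier ℓ₂
    isStrictTotalOrder : IsStrictTotalOrder _≈_ _⊏_
    ⊕-monoˡ-⊏          : ∀ {x y} z → x ⊏ y → (x ⊕ z) ⊏ (y ⊕ z)
    ⊙-positive         : ∀ {x y} → 0# ⊏ x → 0# ⊏ y → 0# ⊏ (x ⊙ y)
    0⊏1                : 0# ⊏ 1#
    discrete           : ∀ {x} → 0# ⊏ x → ¬ (x ⊏ 1#)

  NonNegative : Pred Carrier (ℓ₁ ⊔ˡ ℓ₂)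
  NonNegative x = 0# ⊏ x ⊎ 0# ≈ x

-- ι identifies the structure (𝕎/≈ , ⊕ , ⊙ , ◁) with the non-negative part of R.
record IsNonNegativePart
  {ℓ ℓ′ c ℓ₁ ℓ₂ : Level}
  (_≈_ : Rel 𝕎 ℓ) (_⊕_ _⊙_ : Op₂ 𝕎) (_◁_ : Rel 𝕎 ℓ′)
  (R : DiscretelyOrderedRing c ℓ₁ ℓ₂)
  (ι : 𝕎 → DiscretelyOrderedRing.Carrier R)
  : Set (lsuc 0ℓ ⊔ˡ ℓ ⊔ˡ ℓ′ ⊔ˡ c ⊔ˡ ℓ₁ ⊔ˡ ℓ₂) where
  private module R = DiscretelyOrderedRing R
  field
    isOrderMonomorphism : IsOrderMonomorphism _≈_ R._≈_ _◁_ R._⊏_ ι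
    ⊕-homo              : ∀ X Y → ι (X ⊕ Y) R.≈ (ι X R.⊕ ι Y)
    ⊙-homo              : ∀ X Y → ι (X ⊙ Y) R.≈ (ι X R.⊙ ι Y)
    image-nonNegative   : ∀ r → R.NonNegative r ⇔ (∃[ X ] ι X R.≈ r)

-- An embedding of rings ℤ → R; its image is the subring generated by 1, so
-- this is an identification of the prime subring with ℤ.
IsPrimeSubringIdentification :
  ∀ {c ℓ₁ ℓ₂ : Level} (R : DiscretelyOrderedRing c ℓ₁ ℓ₂) →
  (ℤ → DiscretelyOrderedRing.Carrier R) → Set ℓ₁
IsPrimeSubringIdentification R =
  RingMorphisms.IsRingMonomorphism +-*-rawRing (DiscretelyOrderedRing.rawRing R)

-- A is finite and |A| = m.
HasCardinality : Pred Tuple 0ℓ → ℕ → Set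
HasCardinality A m =
  ∃[ xs ] (Unique xs × List.length xs ≡ m × (∀ a → a ∈ A ⇔ a ∈ˡ xs))

{-# OPTIONS --safe #-}
module Submission where

-- Multipliable representatives come from padding with zeros.  Applying (UP) and
-- (AP) to G = {a 1 0^j : a ∈ A, j ≤ e(a)} and G × {0}, whose differences are
-- A × {1} and {a 1 0^(e(a)+1) : a ∈ A}, shows that A is equinumerous to the
-- latter set.  For e(a) = |a| this set is suffix-free, so it is multipliable with
-- every left factor; for e large enough it is disjoint from any given point set,
-- so every sum X + D is represented by a superset of X.  These two facts make 𝔑
-- a cancellative commutative semiring without zero divisors or negatives in which
-- any two elements differ by a third, and ℜ is its ring of formal differences.
--
-- No excluded middle is needed: (AP) makes ≈ blind to double complements,
-- and (ZP) decides every comparison.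

open import Defs
open import Algebra.Bundles using (CommutativeRing; CommutativeSemiring)
open import Algebra.Core using (Op₁; Op₂)
open import Algebra.Definitions using (RightCancellative; Congruent₂)
import Algebra.Properties.Semiring.Mult as SemiringMult
import Algebra.Solver.Ring.NaturalCoefficients.Default as SemiringSolver
open import Algebra.Structures.Biased using (isCommutativeSemiringʳ)
open import Data.Integer.Base as ℤ using (ℤ; +_; -[1+_])
import Data.Integer.Properties as ℤₚ
open import Data.Integer.Solver using (module +-*-Solver)
open import Data.List.Base as List
  using (List; []; _∷_; _++_; replicate; foldl; take; drop; map; upTo)
open import Data.List.Extrema.Nat using (max; max≤v⁺; ⊥≤max; xs≤max)
open import Data.List.Membership.Propositional using () renaming (_∈_ to _∈ˡ_)
open import Data.List.Membership.Propositional.Properties using (∈-map⁺; ∈-upTo⁺)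
open import Data.List.NonEmpty.Base using ([_]; _∷_; length; toList; _⁺++⁺_)
open import Data.List.Properties
  using (++-assoc; ∷-injective; ∷-injectiveʳ; foldl-++; length-++; length-replicate)
open import Data.List.Relation.Binary.Permutation.Propositional using (↭-reflexive; ↭-trans)
import Data.List.Relation.Binary.Permutation.Propositional.Properties as Permₚ
open import Data.List.Relation.Unary.All as All using (All; []; _∷_)
import Data.List.Relation.Unary.All.Properties as Allₚ
open import Data.List.Relation.Unary.AllPairs using ([]; _∷_)
open import Data.List.Relation.Unary.Any using (here; there)
open import Data.List.Relation.Unary.Unique.Propositional using (Unique)
open import Data.Nat.Base as ℕ using (ℕ; zero; suc; _∸_; z≤n; s≤s)
import Data.Nat.Properties as ℕₚ
open import Data.Product using (∃-syntax; Σ-syntax; _×_; _,_; proj₁; proj₂)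
open import Data.Sum using (_⊎_; inj₁; inj₂; [_,_]′; swap)
open import Function.Base using (_∘_)
open import Function.Bundles using (_⇔_; mk⇔; module Equivalence)
open import Level using (Level; 0ℓ; _⊔_) renaming (suc to lsuc)
open import Relation.Binary.Bundles using (Setoid)
open import Relation.Binary.Core using (Rel)
open import Relation.Binary.Definitions using (Trichotomous; tri<; tri≈; tri>)
import Relation.Binary.Morphism.OrderMonomorphism as OrderMonomorphism
open import Relation.Binary.Morphism.Structures using (IsOrderMonomorphism)
open import Relation.Binary.PropositionalEquality as ≡ using (_≡_; _≢_; module ≡-Reasoning)
open import Relation.Binary.Structures using (IsEquivalence; IsStrictTotalOrder)
open import Relation.Nullary using (¬_; contradiction)
open import Relation.Unary using (Pred; ∅; _∈_; _⊆_; _⊂_; _≐_; _∩_; ｛_｝; Empty)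

-- Formal differences

-- Axioms under which the formal differences of a semiring form a discretely ordered ring with the
-- semiring as its non-negative part. The order is the algebraic one, given by a nonzero difference.
record DifferenceSemiring c ℓ : Set (lsuc (c ⊔ ℓ)) where
  field
    commutativeSemiring : CommutativeSemiring c ℓ

  open CommutativeSemiring commutativeSemiring public

  infix 4 _<_
  _<_ : Rel Carrier (c ⊔ ℓ)
  x < y = ∃[ δ ] (¬ δ ≈ 0# × x + δ ≈ y)

  field
    +-cancelʳ        : RightCancellative _≈_ _+_
    +-conical        : ∀ {x y} → x + y ≈ 0# → x ≈ 0#
    *-nonzero        : ∀ {x y} → ¬ x ≈ 0# → ¬ y ≈ 0# → ¬ x * y ≈ 0#
    1-nonzero        : ¬ 1# ≈ 0#
    1-indecomposable : ∀ {x y} → ¬ x ≈ 0# → ¬ y ≈ 0# → ¬ x + y ≈ 1#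
    total            : ∀ x y → x < y ⊎ x ≈ y ⊎ y < x

module Differences {c ℓ} (S : DifferenceSemiring c ℓ) where
  open DifferenceSemiring S
  open SemiringSolver commutativeSemiring
    using (solve; _:=_; _:+_; _:*_; con)
  open SemiringMult semiring using (×-homo-+; ×1-homo-*) renaming (_×_ to _·_)
  open import Relation.Binary.Reasoning.Setoid setoid

  -- (a , b) stands for the formal difference a − b.
  Difference : Set c
  Difference = Carrier × Carrier

  infix 4 _≃_ _≲[_]_
  infixl 6 _+ᵈ_
  infixl 7 _*ᵈ_

  -- s − r = δ
  _≲[_]_ : Difference → Carrier → Difference → Set ℓ
  (a , b) ≲[ δ ] (c , d) = (a + d) + δ ≈ c + b

  _≃_ : Rel Difference ℓ
  (a , b) ≃ (c , d) = a + d ≈ c + b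

  _+ᵈ_ _*ᵈ_ : Op₂ Difference
  (a , b) +ᵈ (c , d) = a + c , b + d
  (a , b) *ᵈ (c , d) = a * c + b * d , a * d + b * c

  -ᵈ_ : Op₁ Difference
  -ᵈ (a , b) = b , a

  embed : Carrier → Difference
  embed a = a , 0#

  ≃⇒≲ : ∀ {r s} → r ≃ s → r ≲[ 0# ] s
  ≃⇒≲ eq = trans (+-identityʳ _) eq

  ≲⇒≃ : ∀ {r s} → r ≲[ 0# ] s → r ≃ s
  ≲⇒≃ eq = trans (sym (+-identityʳ _)) eq

  ≲-resp : ∀ {δ ε r s} → δ ≈ ε → r ≲[ δ ] s → r ≲[ ε ] s
  ≲-resp δ≈ε eq = trans (+-congˡ (sym δ≈ε)) eq

  -- Adding the two equations leaves a common summand `d`, which cancels. Keeping track of the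
  -- offset lets one computation give transitivity of both `_≃_` and `_⊏ᵈ_`.
  ≲-trans : ∀ {δ ε r s t} → r ≲[ δ ] s → s ≲[ ε ] t → r ≲[ δ + ε ] t
  ≲-trans {δ} {ε} {a , b} {c , d} {e , f} rs st = +-cancelʳ d _ _ (begin
    a + f + (δ + ε) + d     ≈⟨ solve 5 (λ a d f δ ε → a :+ f :+ (δ :+ ε) :+ d
                                 := a :+ d :+ δ :+ (f :+ ε)) refl a d f δ ε ⟩
    a + d + δ + (f + ε)     ≈⟨ +-congʳ rs ⟩
    c + b + (f + ε)         ≈⟨ solve 4 (λ b c f ε → c :+ b :+ (f :+ ε)
                                 := c :+ f :+ ε :+ b) refl b c f ε ⟩
    c + f + ε + b           ≈⟨ +-congʳ st ⟩
    e + d + b               ≈⟨ solve 3 (λ e d b → e :+ d :+ b := e :+ b :+ d) refl e d b ⟩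
    e + b + d               ∎)

  ≃-refl : ∀ {r} → r ≃ r
  ≃-refl = refl

  ≃-sym : ∀ {r s} → r ≃ s → s ≃ r
  ≃-sym = sym

  ≃-trans : ∀ {r s t} → r ≃ s → s ≃ t → r ≃ t
  ≃-trans {r} {s} {t} rs st = ≲⇒≃ {r} {t}
    (≲-resp {r = r} {t} (+-identityʳ 0#)
      (≲-trans {r = r} {s} {t} (≃⇒≲ {r} {s} rs) (≃⇒≲ {s} {t} st)))

  +ᵈ-cong : ∀ {r r′ s s′} → r ≃ r′ → s ≃ s′ → r +ᵈ s ≃ r′ +ᵈ s′
  +ᵈ-cong {a , b} {a′ , b′} {c , d} {c′ , d′} rr′ ss′ = begin
    (a + c) + (b′ + d′)  ≈⟨ exchange a c b′ d′ ⟩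
    (a + b′) + (c + d′)  ≈⟨ +-cong rr′ ss′ ⟩
    (a′ + b) + (c′ + d)  ≈⟨ exchange a′ b c′ d ⟩
    (a′ + c′) + (b + d)  ∎
    where
    exchange = solve 4 (λ p q r s → (p :+ q) :+ (r :+ s) := (p :+ r) :+ (q :+ s)) refl

  *ᵈ-comm : ∀ r s → r *ᵈ s ≃ s *ᵈ r
  *ᵈ-comm (a , b) (c , d) = solve 4 (λ a b c d →
    (a :* c :+ b :* d) :+ (c :* b :+ d :* a) := (c :* a :+ d :* b) :+ (a :* d :+ b :* c))
    refl a b c d

  -- After collecting, the two sides are combinations of `c` and `d` with the coefficients `a + b′`
  -- and `a′ + b` in opposite order, and `r ≃ r′` identifies these coefficients.
  *ᵈ-congʳ : ∀ {r r′} s → r ≃ r′ → r *ᵈ s ≃ r′ *ᵈ s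
  *ᵈ-congʳ {a , b} {a′ , b′} (c , d) rr′ = begin
    (a * c + b * d) + (a′ * d + b′ * c)  ≈⟨ collect a b a′ b′ c d ⟩
    (a + b′) * c + (a′ + b) * d          ≈⟨ +-cong (*-congʳ rr′) (*-congʳ (sym rr′)) ⟩
    (a′ + b) * c + (a + b′) * d          ≈⟨ collect a′ b′ a b c d ⟨
    (a′ * c + b′ * d) + (a * d + b * c)  ∎
    where
    collect = solve 6 (λ a b a′ b′ c d → (a :* c :+ b :* d) :+ (a′ :* d :+ b′ :* c)
      := (a :+ b′) :* c :+ (a′ :+ b) :* d) refl

  *ᵈ-cong : ∀ {r r′ s s′} → r ≃ r′ → s ≃ s′ → r *ᵈ s ≃ r′ *ᵈ s′
  *ᵈ-cong {r} {r′} {s} {s′} rr′ ss′ =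
    ≃-trans {r *ᵈ s} {r′ *ᵈ s} {r′ *ᵈ s′} (*ᵈ-congʳ {r} {r′} s rr′)
      (≃-trans {r′ *ᵈ s} {s *ᵈ r′} {r′ *ᵈ s′} (*ᵈ-comm r′ s)
        (≃-trans {s *ᵈ r′} {s′ *ᵈ r′} {r′ *ᵈ s′} (*ᵈ-congʳ {s} {s′} r′ ss′)
          (*ᵈ-comm s′ r′)))

  commutativeRing : CommutativeRing c ℓ
  commutativeRing = record
    { Carrier = Difference
    ; _≈_     = _≃_
    ; _+_     = _+ᵈ_
    ; _*_     = _*ᵈ_
    ; -_      = -ᵈ_
    ; 0#      = embed 0#
    ; 1#      = embed 1#
    ; isCommutativeRing = record
      { isRing = record
        { +-isAbelianGroup = record
          { isGroup = record
            { isMonoid = record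
              { isSemigroup = record
                { isMagma = record
                  { isEquivalence = record
                    { refl  = λ {r} → ≃-refl {r}
                    ; sym   = λ {r s} → ≃-sym {r} {s}
                    ; trans = λ {r s t} → ≃-trans {r} {s} {t}
                    }
                  ; ∙-cong = λ {r r′ s s′} → +ᵈ-cong {r} {r′} {s} {s′}
                  }
                ; assoc = λ (a , b) (c , d) (e , f) → +-cong (+-assoc a c e) (sym (+-assoc b d f))
                }
              ; identity = (λ (a , b) → +-cong (+-identityˡ a) (sym (+-identityˡ b)))
                         , (λ (a , b) → +-cong (+-identityʳ a) (sym (+-identityʳ b)))
              }
            ; inverse =
                (λ (a , b) → trans (+-identityʳ _) (trans (+-comm b a) (sym (+-identityˡ _))))
              , (λ (a , b) → trans (+-identityʳ _) (trans (+-comm a b) (sym (+-identityˡ _))))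
            ; ⁻¹-cong = λ {(a , b)} {(c , d)} eq → trans (+-comm b c) (trans (sym eq) (+-comm a d))
            }
          ; comm = λ (a , b) (c , d) → +-cong (+-comm a c) (+-comm d b)
          }
        ; *-cong = λ {r r′ s s′} → *ᵈ-cong {r} {r′} {s} {s′}
        ; *-assoc = λ (a , b) (c , d) (e , f) → solve 6 (λ a b c d e f →
            ((a :* c :+ b :* d) :* e :+ (a :* d :+ b :* c) :* f)
              :+ (a :* (c :* f :+ d :* e) :+ b :* (c :* e :+ d :* f))
            := (a :* (c :* e :+ d :* f) :+ b :* (c :* f :+ d :* e))
              :+ ((a :* c :+ b :* d) :* f :+ (a :* d :+ b :* c) :* e))
            refl a b c d e f
        ; *-identity =
            (λ (a , b) → solve 2 (λ a b →
              (con 1 :* a :+ con 0 :* b) :+ b := a :+ (con 1 :* b :+ con 0 :* a)) refl a b)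
          , (λ (a , b) → solve 2 (λ a b →
              (a :* con 1 :+ b :* con 0) :+ b := a :+ (a :* con 0 :+ b :* con 1)) refl a b)
        ; distrib =
            (λ (a , b) (c , d) (e , f) → solve 6 (λ a b c d e f →
              (a :* (c :+ e) :+ b :* (d :+ f))
                :+ ((a :* d :+ b :* c) :+ (a :* f :+ b :* e))
              := ((a :* c :+ b :* d) :+ (a :* e :+ b :* f))
                :+ (a :* (d :+ f) :+ b :* (c :+ e))) refl a b c d e f)
          , (λ (a , b) (c , d) (e , f) → solve 6 (λ a b c d e f →
              ((c :+ e) :* a :+ (d :+ f) :* b)
                :+ ((c :* b :+ d :* a) :+ (e :* b :+ f :* a))
              := ((c :* a :+ d :* b) :+ (e :* a :+ f :* b))
                :+ ((c :+ e) :* b :+ (d :+ f) :* a)) refl a b c d e f)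
        }
      ; *-comm = *ᵈ-comm
      }
    }

  -- The order on formal differences.

  infix 4 _⊏ᵈ_

  _⊏ᵈ_ : Rel Difference (c ⊔ ℓ)
  r ⊏ᵈ s = ∃[ δ ] (¬ δ ≈ 0# × r ≲[ δ ] s)

  δ≈0 : ∀ {x y δ} → x ≈ y → x + δ ≈ y → δ ≈ 0#
  δ≈0 {x} {y} {δ} x≈y x+δ≈y = +-cancelʳ x _ _ (begin
    δ + x   ≈⟨ +-comm δ x ⟩
    x + δ   ≈⟨ x+δ≈y ⟩
    y       ≈⟨ x≈y ⟨
    x       ≈⟨ +-identityˡ x ⟨
    0# + x  ∎)

  ⊏ᵈ-irrefl : ∀ {r s} → r ≃ s → ¬ r ⊏ᵈ s
  ⊏ᵈ-irrefl r≃s (δ , δ≉0 , r≲s) = δ≉0 (δ≈0 r≃s r≲s)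

  ⊏ᵈ-trans : ∀ {r s t} → r ⊏ᵈ s → s ⊏ᵈ t → r ⊏ᵈ t
  ⊏ᵈ-trans {r} {s} {t} (δ , δ≉0 , r≲s) (ε , _ , s≲t) =
    -- `+-conical` keeps the combined offset nonzero.
    δ + ε , δ≉0 ∘ +-conical , ≲-trans {r = r} {s} {t} r≲s s≲t

  ⊏ᵈ-respʳ : ∀ {r s t} → s ≃ t → r ⊏ᵈ s → r ⊏ᵈ t
  ⊏ᵈ-respʳ {r} {s} {t} s≃t (δ , δ≉0 , r≲s) = δ , δ≉0 ,
    ≲-resp {r = r} {t} (+-identityʳ δ) (≲-trans {r = r} {s} {t} r≲s (≃⇒≲ {s} {t} s≃t))

  ⊏ᵈ-respˡ : ∀ {r s t} → s ≃ t → s ⊏ᵈ r → t ⊏ᵈ r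
  ⊏ᵈ-respˡ {r} {s} {t} s≃t (δ , δ≉0 , s≲r) = δ , δ≉0 ,
    ≲-resp {r = t} {r} (+-identityˡ δ)
      (≲-trans {r = t} {s} {r} (≃⇒≲ {t} {s} (≃-sym {s} {t} s≃t)) s≲r)

  ⊏ᵈ-asym : ∀ {r s} → r ⊏ᵈ s → ¬ s ⊏ᵈ r
  ⊏ᵈ-asym {r} {s} r⊏s s⊏r =
    ⊏ᵈ-irrefl {r} {r} (≃-refl {r}) (⊏ᵈ-trans {r} {s} {r} r⊏s s⊏r)

  -- By definition `(a , b) ⊏ᵈ (c , d)` is `a + d < c + b`, so `total` on these two sums decides the
  -- comparison.
  ⊏ᵈ-compare : Trichotomous _≃_ _⊏ᵈ_
  ⊏ᵈ-compare r@(a , b) s@(c , d) with total (a + d) (c + b)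
  ... | inj₁ r⊏s        = tri< r⊏s (λ r≃s → ⊏ᵈ-irrefl {r} {s} r≃s r⊏s) (⊏ᵈ-asym {r} {s} r⊏s)
  ... | inj₂ (inj₁ r≃s) = tri≈ (λ r⊏s → ⊏ᵈ-irrefl {r} {s} r≃s r⊏s) r≃s
                            (λ s⊏r → ⊏ᵈ-irrefl {s} {r} (≃-sym {r} {s} r≃s) s⊏r)
  ... | inj₂ (inj₂ s⊏r) = tri> (⊏ᵈ-asym {s} {r} s⊏r)
                            (λ r≃s → ⊏ᵈ-irrefl {s} {r} (≃-sym {r} {s} r≃s) s⊏r) s⊏r

  ⊏ᵈ-isStrictTotalOrder : IsStrictTotalOrder _≃_ _⊏ᵈ_
  ⊏ᵈ-isStrictTotalOrder = record
    { isStrictPartialOrder = record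
      { isEquivalence = CommutativeRing.isEquivalence commutativeRing
      ; irrefl        = λ {r s} → ⊏ᵈ-irrefl {r} {s}
      ; trans         = λ {r s t} → ⊏ᵈ-trans {r} {s} {t}
      ; <-resp-≈      = (λ {r s t} → ⊏ᵈ-respʳ {r} {s} {t}) , (λ {r s t} → ⊏ᵈ-respˡ {r} {s} {t})
      }
    ; compare = ⊏ᵈ-compare
    }

  +ᵈ-monoˡ-⊏ᵈ : ∀ {r s} t → r ⊏ᵈ s → (r +ᵈ t) ⊏ᵈ (s +ᵈ t)
  +ᵈ-monoˡ-⊏ᵈ {a , b} {c , d} (e , f) (δ , δ≉0 , eq) = δ , δ≉0 , (begin
    ((a + e) + (d + f)) + δ  ≈⟨ solve 5 (λ a d e f δ → ((a :+ e) :+ (d :+ f)) :+ δ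
                                  := ((a :+ d) :+ δ) :+ (e :+ f)) refl a d e f δ ⟩
    ((a + d) + δ) + (e + f)  ≈⟨ +-congʳ eq ⟩
    (c + b) + (e + f)        ≈⟨ solve 4 (λ c b e f → (c :+ b) :+ (e :+ f)
                                  := (c :+ e) :+ (b :+ f)) refl c b e f ⟩
    (c + e) + (b + f)        ∎)

  positive⇒ : ∀ {a b} → embed 0# ⊏ᵈ (a , b) → ∃[ δ ] (¬ δ ≈ 0# × a ≈ b + δ)
  positive⇒ {a} {b} (δ , δ≉0 , eq) = δ , δ≉0 , (begin
    a               ≈⟨ +-identityʳ a ⟨
    a + 0#          ≈⟨ eq ⟨
    (0# + b) + δ    ≈⟨ +-congʳ (+-identityˡ b) ⟩
    b + δ           ∎)

  -- If a = b + δ and c = d + ε then (a − b)(c − d) = δε.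
  *ᵈ-positive : ∀ {r s} → embed 0# ⊏ᵈ r → embed 0# ⊏ᵈ s → embed 0# ⊏ᵈ (r *ᵈ s)
  *ᵈ-positive {a , b} {c , d} 0⊏r 0⊏s with positive⇒ 0⊏r | positive⇒ 0⊏s
  ... | δ , δ≉0 , a≈b+δ | ε , ε≉0 , c≈d+ε = δ * ε , *-nonzero δ≉0 ε≉0 , (begin
    0# + (a * d + b * c) + δ * ε
      ≈⟨ +-congʳ (+-congˡ (+-cong (*-congʳ a≈b+δ) (*-congˡ c≈d+ε))) ⟩
    0# + ((b + δ) * d + b * (d + ε)) + δ * ε
      ≈⟨ solve 4 (λ b d δ ε → con 0 :+ ((b :+ δ) :* d :+ b :* (d :+ ε)) :+ δ :* ε
           := (b :+ δ) :* (d :+ ε) :+ b :* d :+ con 0) refl b d δ ε ⟩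
    (b + δ) * (d + ε) + b * d + 0#
      ≈⟨ +-congʳ (+-congʳ (*-cong a≈b+δ c≈d+ε)) ⟨
    a * c + b * d + 0#  ∎)

  -- The semiring as the non-negative part of its ring of differences.

  embed-cong : ∀ {x y} → x ≈ y → embed x ≃ embed y
  embed-cong = +-congʳ

  embed-injective : ∀ {x y} → embed x ≃ embed y → x ≈ y
  embed-injective = +-cancelʳ 0# _ _

  embed-mono : ∀ {x y} → x < y → embed x ⊏ᵈ embed y
  embed-mono {x} {y} (δ , δ≉0 , eq) = δ , δ≉0 , (begin
    (x + 0#) + δ  ≈⟨ +-congʳ (+-identityʳ x) ⟩
    x + δ         ≈⟨ eq ⟩
    y             ≈⟨ +-identityʳ y ⟨
    y + 0#        ∎)

  embed-cancel : ∀ {x y} → embed x ⊏ᵈ embed y → x < y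
  embed-cancel {x} {y} (δ , δ≉0 , eq) = δ , δ≉0 , (begin
    x + δ         ≈⟨ +-congʳ (+-identityʳ x) ⟨
    (x + 0#) + δ  ≈⟨ eq ⟩
    y + 0#        ≈⟨ +-identityʳ y ⟩
    y             ∎)

  embed-isOrderMonomorphism : IsOrderMonomorphism _≈_ _≃_ _<_ _⊏ᵈ_ embed
  embed-isOrderMonomorphism = record
    { isOrderHomomorphism = record { cong = embed-cong ; mono = embed-mono }
    ; injective           = embed-injective
    ; cancel              = embed-cancel
    }

  embed-+-homo : ∀ x y → embed (x + y) ≃ embed x +ᵈ embed y
  embed-+-homo x y = +-congˡ (+-identityʳ 0#)

  embed-*-homo : ∀ x y → embed (x * y) ≃ embed x *ᵈ embed y
  embed-*-homo = solve 2 (λ x y → x :* y :+ (x :* con 0 :+ con 0 :* y)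
    := (x :* y :+ con 0 :* con 0) :+ con 0) refl

  discretelyOrderedRing : DiscretelyOrderedRing c ℓ (c ⊔ ℓ)
  discretelyOrderedRing = record
    { commutativeRing    = commutativeRing
    ; _⊏_                = _⊏ᵈ_
    ; isStrictTotalOrder = ⊏ᵈ-isStrictTotalOrder
    ; ⊕-monoˡ-⊏          = λ {r s} → +ᵈ-monoˡ-⊏ᵈ {r} {s}
    ; ⊙-positive         = λ {r s} → *ᵈ-positive {r} {s}
    ; 0⊏1                = embed-mono (1# , 1-nonzero , +-identityˡ 1#)
    ; discrete           = discrete
    }
    where
    -- If `a − b` is the nonzero `δ` and falls short of `1#` by the nonzero `ε`, then `δ + ε` is a
    -- forbidden decomposition of `1#`.
    discrete : ∀ {r} → embed 0# ⊏ᵈ r → ¬ r ⊏ᵈ embed 1#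
    discrete {a , b} 0⊏r (ε , ε≉0 , eq) with positive⇒ 0⊏r
    ... | δ , δ≉0 , a≈b+δ = 1-indecomposable δ≉0 ε≉0 (+-cancelʳ b _ _ (begin
      (δ + ε) + b         ≈⟨ solve 3 (λ b δ ε → (δ :+ ε) :+ b
                               := ((b :+ δ) :+ con 0) :+ ε) refl b δ ε ⟩
      ((b + δ) + 0#) + ε  ≈⟨ +-congʳ (+-congʳ a≈b+δ) ⟨
      (a + 0#) + ε        ≈⟨ eq ⟩
      1# + b              ∎))

  open DiscretelyOrderedRing discretelyOrderedRing using (NonNegative)

  -- A positive `(a , b)` has `a ≈ b + δ` and so is the image of `δ`. Conversely, `total 0# x`
  -- leaves only `0# < x` and `0# ≈ x`, because `+-conical` forbids elements below `0#`.
  nonNegative⇔embedded : ∀ r → NonNegative r ⇔ (∃[ x ] embed x ≃ r)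
  nonNegative⇔embedded r@(a , b) = mk⇔ to from
    where
    to : NonNegative r → ∃[ x ] embed x ≃ r
    to (inj₁ 0⊏r) with positive⇒ 0⊏r
    ... | δ , _ , a≈b+δ = δ , (begin
      δ + b   ≈⟨ +-comm δ b ⟩
      b + δ   ≈⟨ a≈b+δ ⟨
      a       ≈⟨ +-identityʳ a ⟨
      a + 0#  ∎)
    to (inj₂ 0≃r) = 0# , 0≃r

    from : (∃[ x ] embed x ≃ r) → NonNegative r
    from (x , x≃r) with total 0# x
    ... | inj₁ 0<x        = inj₁ (⊏ᵈ-respʳ {embed 0#} {embed x} {r} x≃r (embed-mono 0<x))
    ... | inj₂ (inj₁ 0≈x) = inj₂ (≃-trans {embed 0#} {embed x} {r} (embed-cong 0≈x) x≃r)
    ... | inj₂ (inj₂ (δ , δ≉0 , x+δ≈0)) =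
      contradiction (+-conical (trans (+-comm δ x) x+δ≈0)) δ≉0

  -- The integers as prime subring.

  fromℤ : ℤ → Difference
  fromℤ (+ n)    = n · 1# , 0#
  fromℤ -[1+ n ] = 0# , suc n · 1#

  -- Characteristic zero: `+-conical` and `1-nonzero` separate `0#` from the multiples by
  -- successors, and cancelling one `1#` gives the induction step.
  ·-injective : ∀ m n → m · 1# ≈ n · 1# → m ≡ n
  ·-injective zero    zero    _  = ≡.refl
  ·-injective zero    (suc n) eq = contradiction (+-conical (sym eq)) 1-nonzero
  ·-injective (suc m) zero    eq = contradiction (+-conical eq) 1-nonzero
  ·-injective (suc m) (suc n) eq = ≡.cong suc (·-injective m n
    (+-cancelʳ 1# _ _ (trans (+-comm _ 1#) (trans eq (+-comm 1# _)))))

  -- Frees the homomorphism proofs from the case split in `fromℤ`: any presentation of `i` as a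
  -- difference of naturals computes its image, so sums and products reduce to identities between
  -- integers.
  fromℤ-difference : ∀ i m n → i ≡ + m ℤ.- + n → fromℤ i ≃ (m · 1# , n · 1#)
  fromℤ-difference (+ k) m n eq = begin
    k · 1# + n · 1#   ≈⟨ ×-homo-+ 1# k n ⟨
    (k ℕ.+ n) · 1#    ≡⟨ ≡.cong (_· 1#) (ℤₚ.+-injective k+n≡m) ⟩
    m · 1#            ≈⟨ +-identityʳ _ ⟨
    m · 1# + 0#       ∎
    where
    k+n≡m : + k ℤ.+ + n ≡ + m
    k+n≡m = ≡.trans (≡.cong (ℤ._+ + n) eq) (+-*-Solver.solve 2
      (λ m n → (m +-*-Solver.:- n) +-*-Solver.:+ n +-*-Solver.:= m) ≡.refl (+ m) (+ n))
  fromℤ-difference -[1+ k ] m n eq = begin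
    0# + n · 1#           ≈⟨ +-identityˡ _ ⟩
    n · 1#                ≡⟨ ≡.cong (_· 1#) (ℤₚ.+-injective n≡m+k) ⟩
    (m ℕ.+ suc k) · 1#    ≈⟨ ×-homo-+ 1# m (suc k) ⟩
    m · 1# + suc k · 1#   ∎
    where
    n≡m+k : + n ≡ + m ℤ.+ + suc k
    n≡m+k = ≡.trans (+-*-Solver.solve 2 (λ m n → n
        +-*-Solver.:= m +-*-Solver.:- (m +-*-Solver.:- n)) ≡.refl (+ m) (+ n))
      (≡.cong (λ i → + m ℤ.- i) (≡.sym eq))

  difference : ∀ i → ∃[ m ] ∃[ n ] i ≡ + m ℤ.- + n
  difference (+ k)    = k , 0 , ≡.sym (ℤₚ.+-identityʳ (+ k))
  difference -[1+ k ] = 0 , suc k , ≡.refl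

  fromℤ-+-homo : ∀ i j → fromℤ (i ℤ.+ j) ≃ fromℤ i +ᵈ fromℤ j
  fromℤ-+-homo i j with difference i | difference j
  ... | m , n , i≡m-n | p , q , j≡p-q =
    ≃-trans {fromℤ (i ℤ.+ j)} {((m ℕ.+ p) · 1# , (n ℕ.+ q) · 1#)} {fromℤ i +ᵈ fromℤ j}
      (fromℤ-difference (i ℤ.+ j) (m ℕ.+ p) (n ℕ.+ q)
        (≡.trans (≡.cong₂ ℤ._+_ i≡m-n j≡p-q) (+-*-Solver.solve 4
          (λ m n p q → (m :- n) ⊹ (p :- q) ≔ (m ⊹ p) :- (n ⊹ q))
          ≡.refl (+ m) (+ n) (+ p) (+ q))))
      (≃-trans {(m ℕ.+ p) · 1# , (n ℕ.+ q) · 1#} {(m · 1# , n · 1#) +ᵈ (p · 1# , q · 1#)}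
               {fromℤ i +ᵈ fromℤ j}
        (+-cong (×-homo-+ 1# m p) (sym (×-homo-+ 1# n q)))
        (≃-sym {fromℤ i +ᵈ fromℤ j} {(m · 1# , n · 1#) +ᵈ (p · 1# , q · 1#)}
          (+ᵈ-cong {fromℤ i} {m · 1# , n · 1#} {fromℤ j} {p · 1# , q · 1#}
            (fromℤ-difference i m n i≡m-n) (fromℤ-difference j p q j≡p-q))))
    where open +-*-Solver using (_:-_) renaming (_:+_ to _⊹_; _:=_ to _≔_)

  fromℤ-*-homo : ∀ i j → fromℤ (i ℤ.* j) ≃ fromℤ i *ᵈ fromℤ j
  fromℤ-*-homo i j with difference i | difference j
  ... | m , n , i≡m-n | p , q , j≡p-q =
    ≃-trans {fromℤ (i ℤ.* j)} {(k · 1# , l · 1#)} {fromℤ i *ᵈ fromℤ j}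
      (fromℤ-difference (i ℤ.* j) k l
        (≡.trans (≡.cong₂ ℤ._*_ i≡m-n j≡p-q) (≡.trans (+-*-Solver.solve 4
          (λ m n p q → (m :- n) ⋆ (p :- q) ≔ (m ⋆ p ⊹ n ⋆ q) :- (m ⋆ q ⊹ n ⋆ p))
          ≡.refl (+ m) (+ n) (+ p) (+ q))
          (≡.cong₂ ℤ._-_ (cast m p n q) (cast m q n p)))))
      (≃-trans {k · 1# , l · 1#} {(m · 1# , n · 1#) *ᵈ (p · 1# , q · 1#)}
               {fromℤ i *ᵈ fromℤ j}
        (+-cong (split m p n q) (sym (split m q n p)))
        (≃-sym {fromℤ i *ᵈ fromℤ j} {(m · 1# , n · 1#) *ᵈ (p · 1# , q · 1#)}
          (*ᵈ-cong {fromℤ i} {m · 1# , n · 1#} {fromℤ j} {p · 1# , q · 1#}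
            (fromℤ-difference i m n i≡m-n) (fromℤ-difference j p q j≡p-q))))
    where
    open +-*-Solver using (_:-_) renaming (_:+_ to _⊹_; _:*_ to _⋆_; _:=_ to _≔_)
    k l : ℕ
    k = m ℕ.* p ℕ.+ n ℕ.* q
    l = m ℕ.* q ℕ.+ n ℕ.* p
    cast : ∀ a b c d → + a ℤ.* + b ℤ.+ + c ℤ.* + d ≡ + (a ℕ.* b ℕ.+ c ℕ.* d)
    cast a b c d = ≡.cong₂ ℤ._+_ (≡.sym (ℤₚ.pos-* a b)) (≡.sym (ℤₚ.pos-* c d))
    split : ∀ a b c d → (a ℕ.* b ℕ.+ c ℕ.* d) · 1#
          ≈ (a · 1#) * (b · 1#) + (c · 1#) * (d · 1#)
    split a b c d = trans (×-homo-+ 1# (a ℕ.* b) (c ℕ.* d))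
      (+-cong (×1-homo-* a b) (×1-homo-* c d))

  fromℤ-neg-homo : ∀ i → fromℤ (ℤ.- i) ≃ (-ᵈ fromℤ i)
  fromℤ-neg-homo (+ zero)  = refl
  fromℤ-neg-homo (+ suc n) = refl
  fromℤ-neg-homo -[1+ n ]  = refl

  fromℤ-injective : ∀ {i j} → fromℤ i ≃ fromℤ j → i ≡ j
  fromℤ-injective {i} {j} eq with difference i | difference j
  ... | m , n , i≡m-n | p , q , j≡p-q = ≡.trans i≡m-n (≡.trans m-n≡p-q (≡.sym j≡p-q))
    where
    mq≃pn : (m · 1# , n · 1#) ≃ (p · 1# , q · 1#)
    mq≃pn = ≃-trans {m · 1# , n · 1#} {fromℤ i} {p · 1# , q · 1#}
      (≃-sym {fromℤ i} {m · 1# , n · 1#} (fromℤ-difference i m n i≡m-n))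
      (≃-trans {fromℤ i} {fromℤ j} {p · 1# , q · 1#} eq (fromℤ-difference j p q j≡p-q))
    m+q≡p+n : m ℕ.+ q ≡ p ℕ.+ n
    m+q≡p+n = ·-injective _ _
      (trans (×-homo-+ 1# m q) (trans mq≃pn (sym (×-homo-+ 1# p n))))
    m-n≡p-q : + m ℤ.- + n ≡ + p ℤ.- + q
    m-n≡p-q = ≡.trans
      (+-*-Solver.solve 3 (λ m n q → m :- n ≔ (m ⊹ q) :- (n ⊹ q)) ≡.refl (+ m) (+ n) (+ q))
      (≡.trans (≡.cong (λ k → + k ℤ.- (+ n ℤ.+ + q)) m+q≡p+n)
      (+-*-Solver.solve 3 (λ n p q → (p ⊹ n) :- (n ⊹ q) ≔ p :- q) ≡.refl (+ n) (+ p) (+ q)))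
      where open +-*-Solver using (_:-_) renaming (_:+_ to _⊹_; _:=_ to _≔_)

  fromℤ-isPrimeSubringIdentification :
    IsPrimeSubringIdentification discretelyOrderedRing fromℤ
  fromℤ-isPrimeSubringIdentification = record
    { isRingHomomorphism = record
      { isSemiringHomomorphism = record
        { isNearSemiringHomomorphism = record
          { +-isMonoidHomomorphism = record
            { isMagmaHomomorphism = record
              { isRelHomomorphism = record
                { cong = λ {i j} i≡j → reflexive-≃ i j i≡j }
              ; homo = fromℤ-+-homo
              }
            ; ε-homo = refl
            }
          ; *-homo = fromℤ-*-homo
          }
        ; 1#-homo = +-congʳ (+-identityʳ 1#)
        }
      ; -‿homo = fromℤ-neg-homo
      }
    ; injective = fromℤ-injective
    }
    where
    reflexive-≃ : ∀ i j → i ≡ j → fromℤ i ≃ fromℤ j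
    reflexive-≃ i .i ≡.refl = ≃-refl {fromℤ i}

-- Padding and coding of point sets

open import Relation.Binary.PropositionalEquality using (refl; cong; cong₂)
open import Data.Nat.Base using (_≤_; _<_)

-- Unique decomposition of concatenations.

toList-injective : ∀ {a b : Tuple} → toList a ≡ toList b → a ≡ b
toList-injective eq = cong₂ _∷_ (proj₁ (∷-injective eq)) (proj₂ (∷-injective eq))

⁺++⁺-assoc : (a b c : Tuple) → (a ⁺++⁺ b) ⁺++⁺ c ≡ a ⁺++⁺ (b ⁺++⁺ c)
⁺++⁺-assoc a b c = toList-injective (++-assoc (toList a) (toList b) (toList c))

length-⁺++⁺ : (a b : Tuple) → length (a ⁺++⁺ b) ≡ length a ℕ.+ length b
length-⁺++⁺ a b = length-++ (toList a)

++-injective : ∀ {u u′ v v′ : List ℕ} → List.length u ≡ List.length u′ →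
               u ++ v ≡ u′ ++ v′ → u ≡ u′ × v ≡ v′
++-injective {[]}    {[]}     _  eq = refl , eq
++-injective {x ∷ u} {y ∷ u′} |u|≡ eq with ∷-injective eq
... | refl , eq′ with ++-injective {u} {u′} (ℕₚ.suc-injective |u|≡) eq′
...   | refl , v≡v′ = refl , v≡v′

⁺++⁺-injective : ∀ (a a′ : Tuple) {b b′} → length b ≡ length b′ →
                 a ⁺++⁺ b ≡ a′ ⁺++⁺ b′ → a ≡ a′ × b ≡ b′
⁺++⁺-injective a a′ {b} {b′} |b|≡ eq =
  let u≡ , v≡ = ++-injective |a|≡ (cong toList eq)
  in toList-injective u≡ , toList-injective v≡
  where
  |a|≡ : length a ≡ length a′
  |a|≡ = ℕₚ.+-cancelʳ-≡ (length b) _ _ (begin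
    length a ℕ.+ length b     ≡⟨ length-⁺++⁺ a b ⟨
    length (a ⁺++⁺ b)       ≡⟨ cong length eq ⟩
    length (a′ ⁺++⁺ b′)     ≡⟨ length-⁺++⁺ a′ b′ ⟩
    length a′ ℕ.+ length b′   ≡⟨ cong (length a′ ℕ.+_) |b|≡ ⟨
    length a′ ℕ.+ length b    ∎)
    where open ≡-Reasoning

-- A delimiter: in `a ⁺++⁺ marker j` the last nonzero entry is the `1` of the marker, so both `a`
-- and `j` can be recovered.
marker : ℕ → Tuple
marker j = 1 ∷ replicate j 0

length-marker : ∀ j → length (marker j) ≡ suc j
length-marker j = cong suc (length-replicate j)

marker-∷ʳ : ∀ j → marker j ⁺++⁺ [ 0 ] ≡ marker (suc j)
marker-∷ʳ j = cong (1 ∷_) (replicate-∷ʳ j)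
  where
  replicate-∷ʳ : ∀ j → replicate j 0 ++ List.[ 0 ] ≡ replicate (suc j) 0
  replicate-∷ʳ zero    = refl
  replicate-∷ʳ (suc j) = cong (0 ∷_) (replicate-∷ʳ j)

replicate-0≢ : ∀ k (u : List ℕ) {v} → replicate k 0 ≢ u ++ 1 ∷ v
replicate-0≢ (suc k) []      ()
replicate-0≢ (suc k) (x ∷ u) eq = replicate-0≢ k u (∷-injectiveʳ eq)

-- Entries are peeled off both lists together. If one of `u` and `v` ran out first, the `1` of the
-- other marker would fall inside a block of zeros.
++-marker-injective : ∀ u v {j k} →
  u ++ toList (marker j) ≡ v ++ toList (marker k) → u ≡ v × j ≡ k
++-marker-injective []      []      {j} {k} eq = refl , (begin
  j                          ≡⟨ length-replicate j ⟨
  List.length (replicate j 0) ≡⟨ cong List.length (∷-injectiveʳ eq) ⟩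
  List.length (replicate k 0) ≡⟨ length-replicate k ⟩
  k                          ∎)
  where open ≡-Reasoning
++-marker-injective []      (y ∷ v) {j}     eq = contradiction (∷-injectiveʳ eq) (replicate-0≢ j v)
++-marker-injective (x ∷ u) []      {_} {k} eq =
  contradiction (≡.sym (∷-injectiveʳ eq)) (replicate-0≢ k u)
++-marker-injective (x ∷ u) (y ∷ v)         eq with ∷-injective eq
... | refl , eq′ with ++-marker-injective u v eq′
...   | refl , j≡k = refl , j≡k

⁺++⁺-marker-injective : ∀ (a b : Tuple) {j k} →
  a ⁺++⁺ marker j ≡ b ⁺++⁺ marker k → a ≡ b × j ≡ k
⁺++⁺-marker-injective a b eq with ++-marker-injective (toList a) (toList b) (cong toList eq)
... | u≡v , j≡k = toList-injective u≡v , j≡k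

-- Construction of finitary sets, and padding.

height : 𝕎 → ℕ → ℕ
height A n = proj₁ (finitary A n)

length≤height : ∀ A n {a} → a ∈ points A → All (_≤ n) (toList a) → length a ≤ height A n
length≤height A n a∈A all≤ =
  ℕₚ.≮⇒≥ λ lt → proj₂ (finitary A n) _ lt _ (a∈A , refl , all≤)

-- Finitarity read as a bound `h n` on the length of tuples with entries at most `n`, the form in
-- which it is checked below.
bounded : (P : Pred Tuple 0ℓ) (h : ℕ → ℕ) →
          (∀ n {a} → a ∈ P → All (_≤ n) (toList a) → length a ≤ h n) → 𝕎
bounded P h length≤h = mk𝕎 P λ n →
  h n , λ { _ k> _ (a∈P , refl , all≤) → ℕₚ.<⇒≱ k> (length≤h n a∈P all≤) }

subset : (A : 𝕎) (P : Pred Tuple 0ℓ) → P ⊆ points A → 𝕎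
subset A P P⊆A = bounded P (height A) λ n a∈P → length≤height A n (P⊆A a∈P)

∅ʷ : 𝕎
∅ʷ = bounded ∅ (λ _ → 0) λ _ ()

singleton : Tuple → 𝕎
singleton a = bounded ｛ a ｝ (λ _ → length a) λ { _ refl _ → ℕₚ.≤-refl }

Disjoint : Rel 𝕎 0ℓ
Disjoint A B = Empty (points A ∩ points B)

-- `extent` is the function e of the opening sketch; `bound` controls it on tuples with entries at
-- most `n`, which keeps the padded sets finitary.
record Padding (A : 𝕎) : Set where
  field
    extent       : Tuple → ℕ
    bound        : ℕ → ℕ
    extent≤bound : ∀ n {a} → a ∈ points A → All (_≤ n) (toList a) → extent a ≤ bound n

module _ (A : 𝕎) (p : Padding A) where
  open Padding p

  -- The set G of the opening sketch. Each `a` contributes a chain of tuples; appending a `0` moves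
  -- the chain up by one, so G and G × {0} differ only at the two ends of the chains.
  padInitials : 𝕎
  padInitials = bounded
    (λ c → ∃[ a ] ∃[ j ] (a ∈ points A × j ≤ extent a × a ⁺++⁺ marker j ≡ c))
    (λ n → height A n ℕ.+ suc (bound n))
    length≤
    where
    length≤ : ∀ n {c} → ∃[ a ] ∃[ j ] (a ∈ points A × j ≤ extent a × a ⁺++⁺ marker j ≡ c) →
              All (_≤ n) (toList c) → length c ≤ height A n ℕ.+ suc (bound n)
    length≤ n (a , j , a∈A , j≤ , refl) all≤ = begin
      length (a ⁺++⁺ marker j)      ≡⟨ length-⁺++⁺ a (marker j) ⟩
      length a ℕ.+ length (marker j)  ≡⟨ cong (length a ℕ.+_) (length-marker j) ⟩
      length a ℕ.+ suc j              ≤⟨ ℕₚ.+-mono-≤ (length≤height A n a∈A all≤a)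
                                         (s≤s (ℕₚ.≤-trans j≤ (extent≤bound n a∈A all≤a))) ⟩
      height A n ℕ.+ suc (bound n)    ∎
      where
      open ℕₚ.≤-Reasoning
      all≤a : All (_≤ n) (toList a)
      all≤a = Allₚ.++⁻ˡ (toList a) all≤

  Padded : Pred Tuple 0ℓ
  Padded c = ∃[ a ] (a ∈ points A × a ⁺++⁺ marker (suc (extent a)) ≡ c)

  initial-∷ʳ : ∀ a j → (a ⁺++⁺ marker j) ⁺++⁺ [ 0 ] ≡ a ⁺++⁺ marker (suc j)
  initial-∷ʳ a j = ≡.trans (⁺++⁺-assoc a (marker j) [ 0 ]) (cong (a ⁺++⁺_) (marker-∷ʳ j))

  pad : 𝕎
  -- The padded tuple is the top of its chain in G with one more `0`, so finitarity is inherited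
  -- from G × {0}.
  pad = subset (padInitials ×ʷ ⟨ 0 ⟩) Padded λ { (a , a∈A , refl) →
    _ , _ , (a , extent a , a∈A , ℕₚ.≤-refl , refl) , refl , initial-∷ʳ a (extent a) }

  pad≐ : points (padInitials ×ʷ ⟨ 0 ⟩ ∖ʷ padInitials) ≐ points pad
  pad≐ = to , λ p@(a , _ , eq) →
      (_ , _ , (a , extent a , proj₁ (proj₂ p) , ℕₚ.≤-refl , refl) , refl
        , ≡.trans (initial-∷ʳ a (extent a)) eq)
    , notInitial p
    where
    notInitial : ∀ {c} → c ∈ Padded → ¬ c ∈ points padInitials
    notInitial (a , _ , refl) (b , j , _ , j≤ , eq) with ⁺++⁺-marker-injective b a eq
    ... | refl , refl = ℕₚ.<-irrefl refl j≤

    to : points (padInitials ×ʷ ⟨ 0 ⟩ ∖ʷ padInitials) ⊆ Padded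
    -- While `j` is below the extent, appending a `0` stays in G; only the top of the chain leaves
    -- it.
    to ((_ , _ , (a , j , a∈A , j≤ , refl) , refl , refl) , c∉) with ℕₚ.m≤n⇒m<n∨m≡n j≤
    ... | inj₁ j< = contradiction (a , suc j , a∈A , j< , ≡.sym (initial-∷ʳ a j)) c∉
    ... | inj₂ refl = a , a∈A , ≡.sym (initial-∷ʳ a j)

  initial≐ : points (padInitials ∖ʷ padInitials ×ʷ ⟨ 0 ⟩) ≐ points (A ×ʷ ⟨ 1 ⟩)
  initial≐ = to , from
    where
    to : points (padInitials ∖ʷ padInitials ×ʷ ⟨ 0 ⟩) ⊆ points (A ×ʷ ⟨ 1 ⟩)
    -- `marker 0` is `[ 1 ]`, so the bottom of a chain lies in A × {1}; every higher element arises
    -- by appending a `0`.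
    to ((a , zero  , a∈A , j≤ , refl) , c∉) = a , [ 1 ] , a∈A , refl , refl
    to ((a , suc j , a∈A , j≤ , refl) , c∉) = contradiction
      (_ , _ , (a , j , a∈A , ℕₚ.<⇒≤ j≤ , refl) , refl , initial-∷ʳ a j) c∉

    from : points (A ×ʷ ⟨ 1 ⟩) ⊆ points (padInitials ∖ʷ padInitials ×ʷ ⟨ 0 ⟩)
    from (a , _ , a∈A , refl , refl) = (a , 0 , a∈A , z≤n , refl) ,
      λ { (_ , _ , (b , j , _ , _ , refl) , refl , eq) → contradiction
            (proj₂ (⁺++⁺-marker-injective b a (≡.trans (≡.sym (initial-∷ʳ b j)) eq)))
            ℕₚ.1+n≢0 }

-- Suffix-free sets and codes.

lengthPadding : ∀ A → Padding A
lengthPadding A = record { extent = length ; bound = height A ; extent≤bound = length≤height A }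

-- The code a ↦ a 1 0^(|a|+1) can be read off from the right end of any concatenation.
code : 𝕎 → 𝕎
code A = pad A (lengthPadding A)

-- Says that no element of `B` is a proper suffix of another, in the form of unique decoding. Here
-- `a` and `a′` are arbitrary tuples, so `B` can stand to the right of any set.
SuffixFree : Pred 𝕎 0ℓ
SuffixFree B = ∀ a a′ {b b′} → b ∈ points B → b′ ∈ points B →
               a ⁺++⁺ b ≡ a′ ⁺++⁺ b′ → a ≡ a′ × b ≡ b′

suffixFree⇒multipliable : ∀ A {B} → SuffixFree B → Multipliable A B
suffixFree⇒multipliable A sf _ _ b∈B b′∈B ≢ eq =
  let a≡ , b≡ = sf _ _ b∈B b′∈B eq in ≢ (cong₂ _,_ a≡ b≡)

⟨⟩-suffixFree : ∀ n → SuffixFree ⟨ n ⟩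
⟨⟩-suffixFree n a a′ refl refl = ⁺++⁺-injective a a′ refl

×-suffixFree : ∀ {A B} → SuffixFree A → SuffixFree B → SuffixFree (A ×ʷ B)
×-suffixFree sfA sfB x x′ (a , b , a∈A , b∈B , refl) (a′ , b′ , a′∈A , b′∈B , refl) eq
  with sfB (x ⁺++⁺ a) (x′ ⁺++⁺ a′) b∈B b′∈B
         (≡.trans (⁺++⁺-assoc x a b) (≡.trans eq (≡.sym (⁺++⁺-assoc x′ a′ b′))))
... | eq′ , refl with sfA x x′ a∈A a′∈A eq′
...   | refl , refl = refl , refl

-- The zeros of the marker give the length of the encoded tuple, and two equal concatenations whose
-- right parts have the same length split alike.
code-suffixFree : ∀ A → SuffixFree (code A)
code-suffixFree A x x′ (a , _ , refl) (a′ , _ , refl) eq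
  with ⁺++⁺-marker-injective (x ⁺++⁺ a) (x′ ⁺++⁺ a′)
         (≡.trans (⁺++⁺-assoc x a _) (≡.trans eq (≡.sym (⁺++⁺-assoc x′ a′ _))))
... | xa≡ , |a|≡ with ⁺++⁺-injective x x′ (ℕₚ.suc-injective |a|≡) xa≡
...   | refl , refl = refl , refl

code-multipliable : ∀ A B → Multipliable A (code B)
code-multipliable A B = suffixFree⇒multipliable A {code B} (code-suffixFree B)

-- Exchanging the factors of a concatenation.

countZero : ℕ → ℕ → ℕ
countZero n zero    = suc n
countZero n (suc _) = 0

trailingZeros : List ℕ → ℕ
trailingZeros = foldl countZero 0

trailingZeros-marker : ∀ u j → trailingZeros (u ++ toList (marker j)) ≡ j
trailingZeros-marker u j = begin
  trailingZeros (u ++ toList (marker j))  ≡⟨ foldl-++ countZero 0 u (toList (marker j)) ⟩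
  -- The `1` of the marker resets the count, whatever `u` has contributed.
  foldl countZero 0 (replicate j 0)       ≡⟨ zeros 0 j ⟩
  j ℕ.+ 0                                   ≡⟨ ℕₚ.+-identityʳ j ⟩
  j                                       ∎
  where
  open ≡-Reasoning
  zeros : ∀ n j → foldl countZero n (replicate j 0) ≡ j ℕ.+ n
  zeros n zero    = refl
  zeros n (suc j) = ≡.trans (zeros (suc n) j) (ℕₚ.+-suc j n)

-- The value at [] is junk.
toTuple : List ℕ → Tuple
toTuple []       = [ 0 ]
toTuple (x ∷ xs) = x ∷ xs

moveToFront : ℕ → Tuple → Tuple
moveToFront l c = toTuple (drop k (toList c) ++ take k (toList c))
  where k = length c ∸ l

moveToFront-⁺++⁺ : ∀ a b → moveToFront (length b) (a ⁺++⁺ b) ≡ b ⁺++⁺ a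
moveToFront-⁺++⁺ a b = begin
  moveToFront (length b) (a ⁺++⁺ b)
    ≡⟨ cong (λ k → toTuple (drop k ab ++ take k ab)) k≡ ⟩
  toTuple (drop (length a) ab ++ take (length a) ab)
    ≡⟨ cong₂ (λ u v → toTuple (u ++ v)) (drop-length (toList a)) (take-length (toList a)) ⟩
  b ⁺++⁺ a  ∎
  where
  open ≡-Reasoning
  ab = toList (a ⁺++⁺ b)
  k≡ : length (a ⁺++⁺ b) ∸ length b ≡ length a
  k≡ = ≡.trans (cong (_∸ length b) (length-⁺++⁺ a b)) (ℕₚ.m+n∸n≡m (length a) (length b))
  drop-length : ∀ u {v : List ℕ} → drop (List.length u) (u ++ v) ≡ v
  drop-length []      = refl
  drop-length (x ∷ u) = drop-length u
  take-length : ∀ u {v : List ℕ} → take (List.length u) (u ++ v) ≡ u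
  take-length []      = refl
  take-length (x ∷ u) = cong (x ∷_) (take-length u)

-- A code word with t trailing zeros has length 2t.
swapCode : Tuple → Tuple
swapCode c = moveToFront (t ℕ.+ t) c
  where t = trailingZeros (toList c)

-- The trailing zeros of `b` locate the cut whatever `a` is, so a single function on tuples
-- exchanges the factors of all these concatenations, as `TP` requires.
swapCode-⁺++⁺ : ∀ A a {b} → b ∈ points (code A) → swapCode (a ⁺++⁺ b) ≡ b ⁺++⁺ a
swapCode-⁺++⁺ A a (b , _ , refl) = begin
  moveToFront (t ℕ.+ t) (a ⁺++⁺ w)     ≡⟨ cong (λ t → moveToFront (t ℕ.+ t) (a ⁺++⁺ w)) t≡ ⟩
  moveToFront (l ℕ.+ l) (a ⁺++⁺ w)     ≡⟨ cong (λ k → moveToFront k (a ⁺++⁺ w)) |w|≡ ⟨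
  moveToFront (length w) (a ⁺++⁺ w)  ≡⟨ moveToFront-⁺++⁺ a w ⟩
  w ⁺++⁺ a                           ∎
  where
  open ≡-Reasoning
  l = suc (length b)
  w = b ⁺++⁺ marker l
  t = trailingZeros (toList (a ⁺++⁺ w))
  t≡ : t ≡ l
  t≡ = ≡.trans (cong (trailingZeros ∘ toList) (≡.sym (⁺++⁺-assoc a b (marker l))))
         (trailingZeros-marker (toList (a ⁺++⁺ b)) l)
  |w|≡ : length w ≡ l ℕ.+ l
  |w|≡ = ≡.trans (length-⁺++⁺ b (marker l))
    (≡.trans (cong (length b ℕ.+_) (length-marker l)) (ℕₚ.+-suc (length b) l))

-- Padded tuples become longer than every tuple of X with the same maximum.
avoidingPadding : ∀ X A → Padding A
avoidingPadding X A = record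
  { extent       = λ a → height X (max 1 (toList a))
  -- The extent of `a` depends only on `max 1 (toList a)`, which is at most `1 ⊔ n`, so the maximum
  -- of finitely many heights is a bound.
  ; bound        = λ n → max 0 (map (height X) (upTo (suc (1 ℕ.⊔ n))))
  ; extent≤bound = λ n {a} _ all≤ → All.lookup (xs≤max 0 _) (∈-map⁺ (height X) (∈-upTo⁺ (s≤s
      (max≤v⁺ (ℕₚ.m≤m⊔n 1 n) (All.map (λ x≤n → ℕₚ.≤-trans x≤n (ℕₚ.m≤n⊔m 1 n)) all≤)))))
  }

-- `m` is at least 1 so that it bounds the entries of the marker too. The padded tuple then has
-- entries at most `m` but is longer than any such tuple in `X`.
avoiding-disjoint : ∀ X A → Disjoint X (pad A (avoidingPadding X A))
avoiding-disjoint X A _ (c∈X , a , _ , refl) = ℕₚ.<⇒≱ long (length≤height X m c∈X all≤)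
  where
  open ℕₚ.≤-Reasoning
  m = max 1 (toList a)
  e = height X m
  all≤ : All (_≤ m) (toList (a ⁺++⁺ marker (suc e)))
  all≤ = Allₚ.++⁺ (xs≤max 1 (toList a)) (⊥≤max 1 (toList a) ∷ Allₚ.replicate⁺ (suc e) z≤n)
  long : e < length (a ⁺++⁺ marker (suc e))
  long = begin-strict
    e                                   <⟨ ℕₚ.n<1+n e ⟩
    suc e                               ≤⟨ ℕₚ.n≤1+n (suc e) ⟩
    suc (suc e)                         ≡⟨ length-marker (suc e) ⟨
    length (marker (suc e))             ≤⟨ ℕₚ.m≤n+m _ (length a) ⟩
    length a ℕ.+ length (marker (suc e))  ≡⟨ length-⁺++⁺ a (marker (suc e)) ⟨
    length (a ⁺++⁺ marker (suc e))      ∎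

-- Disjointness of products and unions.

-- A common concatenation has only one right factor in the suffix-free `C`, and that factor would
-- lie in both `B` and `B′`.
×-disjoint : ∀ {A A′ B B′ C} → SuffixFree C → points B ⊆ points C → points B′ ⊆ points C →
             Disjoint B B′ → Disjoint (A ×ʷ B) (A′ ×ʷ B′)
×-disjoint sf B⊆C B′⊆C B∩B′=∅ _ ((a , b , _ , b∈B , refl) , a′ , b′ , _ , b′∈B′ , eq)
  with sf a′ a (B′⊆C b′∈B′) (B⊆C b∈B) eq
... | refl , refl = B∩B′=∅ _ (b∈B , b′∈B′)

⟨⟩-disjoint : ∀ A B {m n} → m ≢ n → Disjoint (A ×ʷ ⟨ m ⟩) (B ×ʷ ⟨ n ⟩)
⟨⟩-disjoint A B m≢n _ ((a , _ , _ , refl , refl) , b , _ , _ , refl , eq)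
  with ⁺++⁺-injective b a refl eq
... | _ , refl = m≢n refl

Disjoint-sym : ∀ A B → Disjoint A B → Disjoint B A
Disjoint-sym A B disj x (x∈B , x∈A) = disj x (x∈A , x∈B)

Disjoint-∪ˡ : ∀ A B C → Disjoint A C → Disjoint B C → Disjoint (A ∪ʷ B) C
Disjoint-∪ˡ A B C A∩C=∅ B∩C=∅ x (inj₁ x∈A , x∈C) = A∩C=∅ x (x∈A , x∈C)
Disjoint-∪ˡ A B C A∩C=∅ B∩C=∅ x (inj₂ x∈B , x∈C) = B∩C=∅ x (x∈B , x∈C)

-- The semiring of equinumerosity classes

module Equinumerosity {ℓ} {_≈_ : Rel 𝕎 ℓ} (isEquinumerosity : IsEquinumerosity _≈_) where
  open IsEquinumerosity isEquinumerosity
  open IsEquivalence isEquivalence renaming (refl to ≈-refl; sym to ≈-sym; trans to ≈-trans)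

  setoid : Setoid (lsuc 0ℓ) ℓ
  setoid = record { isEquivalence = isEquivalence }

  open import Relation.Binary.Reasoning.Setoid setoid

  infix 4 _≉_
  _≉_ : Rel 𝕎 ℓ
  A ≉ B = ¬ A ≈ B

  -- Takes the place of excluded middle: a set is equinumerous to its double complement.
  ∖-empty⇒≈ : ∀ {A B} → Empty (points (A ∖ʷ B)) → Empty (points (B ∖ʷ A)) → A ≈ B
  ∖-empty⇒≈ {A} {B} A∖B=∅ B∖A=∅ = Equivalence.from (AP A B)
    (extensional ((λ x∈ → contradiction x∈ (A∖B=∅ _)) , (λ x∈ → contradiction x∈ (B∖A=∅ _))))

  Empty⇒≈∅ : ∀ {A} → Empty (points A) → A ≈ ∅ʷ
  Empty⇒≈∅ A=∅ = extensional ((λ x∈ → A=∅ _ x∈) , λ ())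

  ≺⇒≉ : ∀ {A B} → _≺_ _≈_ A B → A ≉ B
  ≺⇒≉ {A} {B} A≺B A≈B with ZP A B
  ... | tri< _ A≉B _ = A≉B A≈B
  ... | tri≈ A⊀B _ _ = A⊀B A≺B
  ... | tri> _ A≉B _ = A≉B A≈B

  -- `A` and `B` themselves witness `A ≺ B`, which by `ZP` excludes `A ≈ B`: Euclid's principle that
  -- the whole is greater than the part.
  ⊂⇒≉ : ∀ {A B} → points A ⊂ points B → A ≉ B
  ⊂⇒≉ A⊂B = ≺⇒≉ (_ , _ , A⊂B , ≈-refl , ≈-refl)

  ≈∅⇒Empty : ∀ {A} → A ≈ ∅ʷ → Empty (points A)
  ≈∅⇒Empty A≈∅ x x∈A = ⊂⇒≉ ((λ ()) , λ A⊆∅ → A⊆∅ x∈A) (≈-sym A≈∅)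

  -- G and G × {0} are equinumerous by (UP), hence so are their differences.
  pad≈ : ∀ A p → pad A p ≈ A
  pad≈ A p = begin
    pad A p                      ≈⟨ extensional (pad≐ A p) ⟨
    G ×ʷ ⟨ 0 ⟩ ∖ʷ G              ≈⟨ Equivalence.to (AP _ _) (UP G 0) ⟩
    G ∖ʷ G ×ʷ ⟨ 0 ⟩              ≈⟨ extensional (initial≐ A p) ⟩
    A ×ʷ ⟨ 1 ⟩                   ≈⟨ UP A 1 ⟩
    A                            ∎
    where G = padInitials A p

  code≈ : ∀ A → code A ≈ A
  code≈ A = pad≈ A (lengthPadding A)

  -- Disjoint unions.

  -- Adjoining a disjoint `C` to both sets leaves their two differences unchanged, and by `AP` these
  -- decide equinumerosity. One direction yields congruence of sums, the other cancellation.
  ∪-congʳ⇔ : ∀ A A′ C → Disjoint A C → Disjoint A′ C → (A ≈ A′) ⇔ ((A ∪ʷ C) ≈ (A′ ∪ʷ C))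
  ∪-congʳ⇔ A A′ C A∩C=∅ A′∩C=∅ = mk⇔
    (λ A≈A′ → Equivalence.from (AP _ _) (begin
      A ∪ʷ C ∖ʷ (A′ ∪ʷ C)  ≈⟨ strip A A′ A∩C=∅ ⟩
      A ∖ʷ A′              ≈⟨ Equivalence.to (AP _ _) A≈A′ ⟩
      A′ ∖ʷ A              ≈⟨ strip A′ A A′∩C=∅ ⟨
      A′ ∪ʷ C ∖ʷ (A ∪ʷ C)  ∎))
    (λ AC≈A′C → Equivalence.from (AP _ _) (begin
      A ∖ʷ A′              ≈⟨ strip A A′ A∩C=∅ ⟨
      A ∪ʷ C ∖ʷ (A′ ∪ʷ C)  ≈⟨ Equivalence.to (AP _ _) AC≈A′C ⟩
      A′ ∪ʷ C ∖ʷ (A ∪ʷ C)  ≈⟨ strip A′ A A′∩C=∅ ⟩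
      A′ ∖ʷ A              ∎))
    where
    strip : ∀ A B → Disjoint A C → (A ∪ʷ C ∖ʷ (B ∪ʷ C)) ≈ (A ∖ʷ B)
    strip A B A∩C=∅ = extensional
      ( (λ { (inj₁ x∈A , x∉) → x∈A , x∉ ∘ inj₁
           ; (inj₂ x∈C , x∉) → contradiction (inj₂ x∈C) x∉ })
      , (λ { (x∈A , x∉B) → inj₁ x∈A , [ x∉B , (λ x∈C → A∩C=∅ _ (x∈A , x∈C)) ]′ }))

  ∪-comm : ∀ A B → (A ∪ʷ B) ≈ (B ∪ʷ A)
  ∪-comm A B = extensional (swap , swap)

  -- `A` and `B` are replaced one after the other. Since `A′` may meet `B`, old sets carry the tag 0
  -- and new ones the tag 1, so that every intermediate union is disjoint.
  ∪-cong : ∀ {A A′ B B′} → Disjoint A B → Disjoint A′ B′ →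
           A ≈ A′ → B ≈ B′ → (A ∪ʷ B) ≈ (A′ ∪ʷ B′)
  ∪-cong {A} {A′} {B} {B′} A∩B=∅ A′∩B′=∅ A≈A′ B≈B′ = begin
    A ∪ʷ B                  ≈⟨ UP (A ∪ʷ B) 0 ⟨
    (A ∪ʷ B) ×ʷ ⟨ 0 ⟩       ≈⟨ ∪-×-distrib A B 0 ⟩
    A ×ʷ ⟨ 0 ⟩ ∪ʷ B ×ʷ ⟨ 0 ⟩
      ≈⟨ Equivalence.to (∪-congʳ⇔ (A ×ʷ ⟨ 0 ⟩) (A′ ×ʷ ⟨ 1 ⟩) (B ×ʷ ⟨ 0 ⟩)
           (tagged A B A∩B=∅) (⟨⟩-disjoint A′ B λ ()))
           (≈-trans (UP A 0) (≈-trans A≈A′ (≈-sym (UP A′ 1)))) ⟩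
    A′ ×ʷ ⟨ 1 ⟩ ∪ʷ B ×ʷ ⟨ 0 ⟩    ≈⟨ ∪-comm (A′ ×ʷ ⟨ 1 ⟩) (B ×ʷ ⟨ 0 ⟩) ⟩
    B ×ʷ ⟨ 0 ⟩ ∪ʷ A′ ×ʷ ⟨ 1 ⟩
      ≈⟨ Equivalence.to (∪-congʳ⇔ (B ×ʷ ⟨ 0 ⟩) (B′ ×ʷ ⟨ 1 ⟩) (A′ ×ʷ ⟨ 1 ⟩)
           (⟨⟩-disjoint B A′ λ ()) (tagged B′ A′ (Disjoint-sym A′ B′ A′∩B′=∅)))
           (≈-trans (UP B 0) (≈-trans B≈B′ (≈-sym (UP B′ 1)))) ⟩
    B′ ×ʷ ⟨ 1 ⟩ ∪ʷ A′ ×ʷ ⟨ 1 ⟩   ≈⟨ ∪-comm (B′ ×ʷ ⟨ 1 ⟩) (A′ ×ʷ ⟨ 1 ⟩) ⟩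
    A′ ×ʷ ⟨ 1 ⟩ ∪ʷ B′ ×ʷ ⟨ 1 ⟩   ≈⟨ ∪-×-distrib A′ B′ 1 ⟨
    (A′ ∪ʷ B′) ×ʷ ⟨ 1 ⟩     ≈⟨ UP (A′ ∪ʷ B′) 1 ⟩
    A′ ∪ʷ B′                ∎
    where
    ∪-×-distrib : ∀ A B n → ((A ∪ʷ B) ×ʷ ⟨ n ⟩) ≈ (A ×ʷ ⟨ n ⟩ ∪ʷ B ×ʷ ⟨ n ⟩)
    ∪-×-distrib A B n = extensional
      ( (λ { (a , t , inj₁ a∈A , t∈ , eq) → inj₁ (a , t , a∈A , t∈ , eq)
           ; (a , t , inj₂ a∈B , t∈ , eq) → inj₂ (a , t , a∈B , t∈ , eq) })
      , (λ { (inj₁ (a , t , a∈A , t∈ , eq)) → a , t , inj₁ a∈A , t∈ , eq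
           ; (inj₂ (a , t , a∈B , t∈ , eq)) → a , t , inj₂ a∈B , t∈ , eq }))

    tagged : ∀ A B {n} → Disjoint A B → Disjoint (A ×ʷ ⟨ n ⟩) (B ×ʷ ⟨ n ⟩)
    tagged A B A∩B=∅ _ ((a , _ , a∈A , refl , refl) , b , _ , b∈B , refl , eq)
      with ⁺++⁺-injective b a refl eq
    ... | refl , _ = A∩B=∅ _ (a∈A , b∈B)

  -- Addition of classes.

  infixl 6 _⊕_
  infixl 7 _⊙_

  -- Tags in the last coordinate make the summands disjoint, and coding the right factor makes the
  -- factors multipliable, so both operations are total on `𝕎`.
  _⊕_ _⊙_ : Op₂ 𝕎
  A ⊕ B = A ×ʷ ⟨ 0 ⟩ ∪ʷ B ×ʷ ⟨ 1 ⟩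
  A ⊙ B = A ×ʷ code B

  ⊕-disjoint : ∀ A B → Disjoint (A ×ʷ ⟨ 0 ⟩) (B ×ʷ ⟨ 1 ⟩)
  ⊕-disjoint A B = ⟨⟩-disjoint A B λ ()

  ⊕≈∪ : ∀ A B → Disjoint A B → (A ⊕ B) ≈ (A ∪ʷ B)
  ⊕≈∪ A B A∩B=∅ = ∪-cong (⊕-disjoint A B) A∩B=∅ (UP A 0) (UP B 1)

  ⊕-cong : Congruent₂ _≈_ _⊕_
  ⊕-cong {A} {A′} {B} {B′} A≈A′ B≈B′ = ∪-cong (⊕-disjoint A B) (⊕-disjoint A′ B′)
    (≈-trans (UP A 0) (≈-trans A≈A′ (≈-sym (UP A′ 0))))
    (≈-trans (UP B 1) (≈-trans B≈B′ (≈-sym (UP B′ 1))))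

  ⊕-congˡ : ∀ A {B B′} → B ≈ B′ → (A ⊕ B) ≈ (A ⊕ B′)
  ⊕-congˡ A {B} {B′} = ⊕-cong {A} {A} {B} {B′} ≈-refl

  ⊕-comm : ∀ A B → (A ⊕ B) ≈ (B ⊕ A)
  ⊕-comm A B = begin
    A ×ʷ ⟨ 0 ⟩ ∪ʷ B ×ʷ ⟨ 1 ⟩  ≈⟨ ∪-comm (A ×ʷ ⟨ 0 ⟩) (B ×ʷ ⟨ 1 ⟩) ⟩
    B ×ʷ ⟨ 1 ⟩ ∪ʷ A ×ʷ ⟨ 0 ⟩  ≈⟨ ⊕≈∪ (B ×ʷ ⟨ 1 ⟩) (A ×ʷ ⟨ 0 ⟩) (⟨⟩-disjoint B A λ ()) ⟨
    B ×ʷ ⟨ 1 ⟩ ⊕ A ×ʷ ⟨ 0 ⟩   ≈⟨ ⊕-cong (UP B 1) (UP A 0) ⟩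
    B ⊕ A                     ∎

  -- Both bracketings are compared with the union of copies tagged 0, 1 and 2, which are pairwise
  -- disjoint.
  ⊕-assoc : ∀ A B C → ((A ⊕ B) ⊕ C) ≈ (A ⊕ (B ⊕ C))
  ⊕-assoc A B C = begin
    (A ⊕ B) ⊕ C
      ≈⟨ ∪-cong (⊕-disjoint (A ⊕ B) C)
           (Disjoint-∪ˡ A₀ B₁ C₂ (⟨⟩-disjoint A C λ ()) (⟨⟩-disjoint B C λ ()))
           (UP (A ⊕ B) 0) (≈-trans (UP C 1) (≈-sym (UP C 2))) ⟩
    A₀ ∪ʷ B₁ ∪ʷ C₂
      ≈⟨ extensional ( (λ { (inj₁ (inj₁ x)) → inj₁ x ; (inj₁ (inj₂ x)) → inj₂ (inj₁ x)
                          ; (inj₂ x) → inj₂ (inj₂ x) })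
                     , (λ { (inj₁ x) → inj₁ (inj₁ x) ; (inj₂ (inj₁ x)) → inj₁ (inj₂ x)
                          ; (inj₂ (inj₂ x)) → inj₂ x })) ⟩
    A₀ ∪ʷ (B₁ ∪ʷ C₂)
      ≈⟨ ∪-cong {A₀} {A₀} {B₁ ∪ʷ C₂} {(B ⊕ C) ×ʷ ⟨ 1 ⟩} (Disjoint-sym (B₁ ∪ʷ C₂) A₀
                  (Disjoint-∪ˡ B₁ C₂ A₀ (⟨⟩-disjoint B A λ ()) (⟨⟩-disjoint C A λ ())))
           (⊕-disjoint A (B ⊕ C)) ≈-refl B₁∪C₂≈ ⟩
    A ⊕ (B ⊕ C)  ∎
    where
    A₀ = A ×ʷ ⟨ 0 ⟩
    B₁ = B ×ʷ ⟨ 1 ⟩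
    C₂ = C ×ʷ ⟨ 2 ⟩
    B₁∪C₂≈ : (B₁ ∪ʷ C₂) ≈ ((B ⊕ C) ×ʷ ⟨ 1 ⟩)
    B₁∪C₂≈ = begin
      B₁ ∪ʷ C₂           ≈⟨ ⊕≈∪ B₁ C₂ (⟨⟩-disjoint B C λ ()) ⟨
      B₁ ⊕ C₂            ≈⟨ ⊕-cong (UP B 1) (UP C 2) ⟩
      B ⊕ C              ≈⟨ UP (B ⊕ C) 1 ⟨
      (B ⊕ C) ×ʷ ⟨ 1 ⟩   ∎

  ⊕-identityʳ : ∀ A → (A ⊕ ∅ʷ) ≈ A
  ⊕-identityʳ A = ≈-trans (⊕≈∪ A ∅ʷ (λ { _ (_ , ()) }))
    (extensional ((λ { (inj₁ x∈A) → x∈A ; (inj₂ ()) }) , inj₁))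

  ⊕-cancelʳ : RightCancellative _≈_ _⊕_
  ⊕-cancelʳ C A B AC≈BC = begin
    A           ≈⟨ UP A 0 ⟨
    A ×ʷ ⟨ 0 ⟩  ≈⟨ Equivalence.from (∪-congʳ⇔ (A ×ʷ ⟨ 0 ⟩) (B ×ʷ ⟨ 0 ⟩) (C ×ʷ ⟨ 1 ⟩)
                    (⊕-disjoint A C) (⊕-disjoint B C)) AC≈BC ⟩
    B ×ʷ ⟨ 0 ⟩  ≈⟨ UP B 0 ⟩
    B           ∎

  -- Multiplication of classes.

  ⊙≈× : ∀ A B → Multipliable A B → (A ⊙ B) ≈ (A ×ʷ B)
  ⊙≈× A B A×B = PP {A} {code B} {A} {B} (code-multipliable A B) A×B ≈-refl (code≈ B)

  ⊙-cong : Congruent₂ _≈_ _⊙_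
  ⊙-cong {A} {A′} {B} {B′} A≈A′ B≈B′ =
    PP {A} {code B} {A′} {code B′} (code-multipliable A B) (code-multipliable A′ B′) A≈A′
      (≈-trans (code≈ B) (≈-trans B≈B′ (≈-sym (code≈ B′))))

  ⊙-congˡ : ∀ A {B B′} → B ≈ B′ → (A ⊙ B) ≈ (A ⊙ B′)
  ⊙-congˡ A {B} {B′} = ⊙-cong {A} {A} {B} {B′} ≈-refl

  -- With both factors coded, exchanging them is a rearrangement of coordinates performed by
  -- `swapCode`, so `TP` applies.
  ⊙-comm : ∀ A B → (A ⊙ B) ≈ (B ⊙ A)
  ⊙-comm A B = begin
    A ×ʷ code B                    ≈⟨ PP {A} {code B} {code A} {code B} (code-multipliable A B)
                                        (code-multipliable (code A) B) (≈-sym (code≈ A)) ≈-refl ⟩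
    code A ×ʷ code B               ≈⟨ TP (code A ×ʷ code B) swapCode permutes injective ⟩
    image swapCode (code A ×ʷ code B) permutes  ≈⟨ extensional (image⊆ , ⊆image) ⟩
    code B ×ʷ code A               ≈⟨ PP {code B} {code A} {B} {code A}
                                        (code-multipliable (code B) A) (code-multipliable B A)
                                        (code≈ B) ≈-refl ⟩
    B ×ʷ code A                    ∎
    where
    permutes : PermutesCoordinatesOn (points (code A ×ʷ code B)) swapCode
    permutes (a , b , _ , b∈ , refl) =
      ↭-trans (↭-reflexive (cong toList (swapCode-⁺++⁺ B a b∈)))
        (Permₚ.++-comm (toList b) (toList a))

    injective : InjectiveOn (points (code A ×ʷ code B)) swapCode
    injective (a , b , a∈ , b∈ , refl) (a′ , b′ , a′∈ , b′∈ , refl) eq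
      -- After the exchange the right factor is a code word of `A`, from which both factors are
      -- decoded.
      with code-suffixFree A b b′ a∈ a′∈
             (≡.trans (≡.sym (swapCode-⁺++⁺ B a b∈)) (≡.trans eq (swapCode-⁺++⁺ B a′ b′∈)))
    ... | refl , refl = refl

    image⊆ : points (image swapCode (code A ×ʷ code B) permutes) ⊆ points (code B ×ʷ code A)
    image⊆ (_ , (a , b , a∈ , b∈ , refl) , refl) =
      b , a , b∈ , a∈ , ≡.sym (swapCode-⁺++⁺ B a b∈)

    ⊆image : points (code B ×ʷ code A) ⊆ points (image swapCode (code A ×ʷ code B) permutes)
    ⊆image (b , a , b∈ , a∈ , refl) =
      _ , (a , b , a∈ , b∈ , refl) , swapCode-⁺++⁺ B a b∈

  -- A product of two codes is again suffix-free, so `PP` allows `code (B ⊙ C)` to replace it to the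
  -- right of `A`.
  ⊙-assoc : ∀ A B C → ((A ⊙ B) ⊙ C) ≈ (A ⊙ (B ⊙ C))
  ⊙-assoc A B C = begin
    A ×ʷ code B ×ʷ code C    ≈⟨ extensional
      ( (λ { (_ , c , (a , b , a∈ , b∈ , refl) , c∈ , refl) →
               a , _ , a∈ , (b , c , b∈ , c∈ , refl) , ≡.sym (⁺++⁺-assoc a b c) })
      , (λ { (a , _ , a∈ , (b , c , b∈ , c∈ , refl) , refl) →
               _ , c , (a , b , a∈ , b∈ , refl) , c∈ , ⁺++⁺-assoc a b c })) ⟩
    A ×ʷ (code B ×ʷ code C)  ≈⟨ PP {A} {code B ×ʷ code C} {A} {code (B ⊙ C)}
      (suffixFree⇒multipliable A {code B ×ʷ code C}
        (×-suffixFree {code B} {code C} (code-suffixFree B) (code-suffixFree C)))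
      (code-multipliable A (B ⊙ C)) ≈-refl
      (begin
        code B ×ʷ code C   ≈⟨ PP {code B} {code C} {B} {code C} (code-multipliable (code B) C)
                                (code-multipliable B C) (code≈ B) ≈-refl ⟩
        B ⊙ C              ≈⟨ code≈ (B ⊙ C) ⟨
        code (B ⊙ C)       ∎) ⟩
    A ×ʷ code (B ⊙ C)        ∎

  ⊙-identityʳ : ∀ A → (A ⊙ ⟨ 0 ⟩) ≈ A
  ⊙-identityʳ A = ≈-trans
    (⊙≈× A ⟨ 0 ⟩ (suffixFree⇒multipliable A {⟨ 0 ⟩} (⟨⟩-suffixFree 0))) (UP A 0)

  -- The code word of a tuple depends on the tuple alone, so coding commutes with unions and the two
  -- sides become the same set once the summands are tagged.
  ⊙-distribˡ : ∀ A B C → (A ⊙ (B ⊕ C)) ≈ (A ⊙ B ⊕ A ⊙ C)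
  ⊙-distribˡ A B C = begin
    A ×ʷ code (B₀ ∪ʷ C₁)  ≈⟨ extensional
      ( (λ { (a , _ , a∈ , (b , inj₁ b∈ , refl) , refl) → inj₁ (a , _ , a∈ , (b , b∈ , refl) , refl)
           ; (a , _ , a∈ , (c , inj₂ c∈ , refl) , refl) →
               inj₂ (a , _ , a∈ , (c , c∈ , refl) , refl) })
      , (λ { (inj₁ (a , _ , a∈ , (b , b∈ , refl) , refl)) → a , _ , a∈ , (b , inj₁ b∈ , refl) , refl
           ; (inj₂ (a , _ , a∈ , (c , c∈ , refl) , refl)) →
               a , _ , a∈ , (c , inj₂ c∈ , refl) , refl })) ⟩
    A ⊙ B₀ ∪ʷ A ⊙ C₁      ≈⟨ ⊕≈∪ (A ⊙ B₀) (A ⊙ C₁) disjoint ⟨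
    A ⊙ B₀ ⊕ A ⊙ C₁       ≈⟨ ⊕-cong (⊙-congˡ A (UP B 0)) (⊙-congˡ A (UP C 1)) ⟩
    A ⊙ B ⊕ A ⊙ C         ∎
    where
    B₀ = B ×ʷ ⟨ 0 ⟩
    C₁ = C ×ʷ ⟨ 1 ⟩

    codes-disjoint : Disjoint (code B₀) (code C₁)
    codes-disjoint _ ((b , b∈ , refl) , c , c∈ , eq) with ⁺++⁺-marker-injective c b eq
    ... | refl , _ = ⊕-disjoint B C _ (b∈ , c∈)

    disjoint : Disjoint (A ⊙ B₀) (A ⊙ C₁)
    disjoint = ×-disjoint {A} {A} {code B₀} {code C₁} {code (B₀ ∪ʷ C₁)} (code-suffixFree (B₀ ∪ʷ C₁))
      (λ { (b , b∈ , eq) → b , inj₁ b∈ , eq }) (λ { (c , c∈ , eq) → c , inj₂ c∈ , eq })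
      codes-disjoint

  ⊙-zeroʳ : ∀ A → (A ⊙ ∅ʷ) ≈ ∅ʷ
  ⊙-zeroʳ A = Empty⇒≈∅ λ { _ (_ , _ , _ , (_ , () , _) , _) }

  commutativeSemiring : CommutativeSemiring (lsuc 0ℓ) ℓ
  commutativeSemiring = record
    { Carrier = 𝕎
    ; _≈_     = _≈_
    ; _+_     = _⊕_
    ; _*_     = _⊙_
    ; 0#      = ∅ʷ
    ; 1#      = ⟨ 0 ⟩
    ; isCommutativeSemiring = isCommutativeSemiringʳ record
      { +-isCommutativeMonoid = record
        { isMonoid = record
          { isSemigroup = record
            { isMagma = record { isEquivalence = isEquivalence ; ∙-cong = ⊕-cong }
            ; assoc   = ⊕-assoc
            }
          ; identity = (λ A → ≈-trans (⊕-comm ∅ʷ A) (⊕-identityʳ A)) , ⊕-identityʳ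
          }
        ; comm = ⊕-comm
        }
      ; *-isCommutativeMonoid = record
        { isMonoid = record
          { isSemigroup = record
            { isMagma = record { isEquivalence = isEquivalence ; ∙-cong = ⊙-cong }
            ; assoc   = ⊙-assoc
            }
          ; identity = (λ A → ≈-trans (⊙-comm ⟨ 0 ⟩ A) (⊙-identityʳ A)) , ⊙-identityʳ
          }
        ; comm = ⊙-comm
        }
      ; distribˡ = ⊙-distribˡ
      ; zeroʳ    = ⊙-zeroʳ
      }
    }

  -- Zero and one.

  ⊕-conical : ∀ {A B} → (A ⊕ B) ≈ ∅ʷ → A ≈ ∅ʷ
  ⊕-conical A⊕B≈∅ = Empty⇒≈∅ λ a a∈A →
    ≈∅⇒Empty A⊕B≈∅ _ (inj₁ (a , _ , a∈A , refl , refl))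

  -- `A ≉ ∅ʷ` provides no element, but the goal is a negation, so elements `a` and `b` may be
  -- assumed; together they give an element of `A ⊙ B`.
  ⊙-nonzero : ∀ {A B} → A ≉ ∅ʷ → B ≉ ∅ʷ → (A ⊙ B) ≉ ∅ʷ
  ⊙-nonzero A≉∅ B≉∅ A⊙B≈∅ = A≉∅ (Empty⇒≈∅ λ a a∈A → B≉∅ (Empty⇒≈∅ λ b b∈B →
    ≈∅⇒Empty A⊙B≈∅ _ (a , _ , a∈A , (b , b∈B , refl) , refl)))

  ⟨0⟩-nonzero : ⟨ 0 ⟩ ≉ ∅ʷ
  ⟨0⟩-nonzero ⟨0⟩≈∅ = ≈∅⇒Empty ⟨0⟩≈∅ _ refl

  -- For a 1-tuple, commutativity turns `N ⊙ O` into `O ×ʷ N`, where `UP` removes `n`. A longer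
  -- tuple is a product of singletons, and induction gives a power of one.
  singleton≈⟨0⟩ : ∀ n as → singleton (n ∷ as) ≈ ⟨ 0 ⟩
  singleton≈⟨0⟩ n [] = begin
    singleton [ n ]  ≈⟨ extensional ((λ x → x) , (λ x → x)) ⟩
    N                ≈⟨ ⊙-identityʳ N ⟨
    N ⊙ O            ≈⟨ ⊙-comm N O ⟩
    O ⊙ N            ≈⟨ ⊙≈× O N (suffixFree⇒multipliable O {N} (⟨⟩-suffixFree n)) ⟩
    O ×ʷ N           ≈⟨ UP O n ⟩
    O                ∎
    where
    N = ⟨ n ⟩
    O = ⟨ 0 ⟩
  singleton≈⟨0⟩ n (m ∷ as) = begin
    singleton (n ∷ m ∷ as)  ≈⟨ extensional
      ( (λ { refl → _ , _ , refl , refl , refl }) , λ { (_ , _ , refl , refl , eq) → eq }) ⟩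
    -- Singletons are multipliable because there is only one pair.
    N ×ʷ A                  ≈⟨ ⊙≈× N A (λ { refl refl refl refl ≢ _ → ≢ refl }) ⟨
    N ⊙ A                   ≈⟨ ⊙-cong (singleton≈⟨0⟩ n []) (singleton≈⟨0⟩ m as) ⟩
    O ⊙ O                   ≈⟨ ⊙-identityʳ O ⟩
    O                       ∎
    where
    N = ⟨ n ⟩
    A = singleton (m ∷ as)
    O = ⟨ 0 ⟩

  -- Elements of `A` and `B` give two distinct elements of `A ⊕ B`, which therefore properly
  -- contains a singleton, and every singleton is equinumerous to `⟨ 0 ⟩`.
  ⟨0⟩-indecomposable : ∀ {A B} → A ≉ ∅ʷ → B ≉ ∅ʷ → (A ⊕ B) ≉ ⟨ 0 ⟩
  ⟨0⟩-indecomposable {A} {B} A≉∅ B≉∅ A⊕B≈⟨0⟩ =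
    A≉∅ (Empty⇒≈∅ λ a a∈A → B≉∅ (Empty⇒≈∅ λ b b∈B →
      let a₀ = a ⁺++⁺ [ 0 ]
          b₁ = b ⁺++⁺ [ 1 ]
          a₀∈A⊕B = inj₁ (a , _ , a∈A , refl , refl)
          b₁∈A⊕B = inj₂ (b , _ , b∈B , refl , refl)
          a₀≢b₁ : a₀ ≢ b₁
          a₀≢b₁ eq = contradiction (proj₂ (⁺++⁺-injective a b refl eq)) λ ()
      in ⊂⇒≉ {singleton a₀} {A ⊕ B}
           ((λ { refl → a₀∈A⊕B }) , λ A⊕B⊆ → a₀≢b₁ (A⊕B⊆ b₁∈A⊕B))
           (≈-trans (singleton≈⟨0⟩ _ _) (≈-sym A⊕B≈⟨0⟩))))

  -- The order on classes.

  infix 4 _≺ᵈ_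
  -- This is `_<_` of `DifferenceSemiring`; its invariance under `≈` follows from that of `_⊕_`.
  _≺ᵈ_ : Rel 𝕎 (lsuc 0ℓ ⊔ ℓ)
  A ≺ᵈ B = ∃[ D ] (D ≉ ∅ʷ × (A ⊕ D) ≈ B)

  ⊂⇒≺ᵈ : ∀ {A B} → points A ⊂ points B → A ≺ᵈ B
  ⊂⇒≺ᵈ {A} {B} A⊂B@(A⊆B , _) = B ∖ʷ A , D≉∅ , A⊕D≈B
    where
    A⊕D≈B : (A ⊕ (B ∖ʷ A)) ≈ B
    A⊕D≈B = begin
      A ⊕ (B ∖ʷ A)   ≈⟨ ⊕≈∪ A (B ∖ʷ A) (λ { _ (x∈A , _ , x∉A) → x∉A x∈A }) ⟩
      -- Constructively the union may miss points of `B`, but no point of `B` can be shown to lie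
      -- outside it, and this is enough for equinumerosity.
      A ∪ʷ (B ∖ʷ A)  ≈⟨ ∖-empty⇒≈
        (λ { _ (inj₁ x∈A , x∉B) → x∉B (A⊆B x∈A) ; _ (inj₂ (x∈B , _) , x∉B) → x∉B x∈B })
        (λ { _ (x∈B , x∉) → x∉ (inj₂ (x∈B , x∉ ∘ inj₁)) }) ⟩
      B              ∎
    D≉∅ : (B ∖ʷ A) ≉ ∅ʷ
    D≉∅ D≈∅ = ⊂⇒≉ A⊂B (begin
      A             ≈⟨ ⊕-identityʳ A ⟨
      A ⊕ ∅ʷ        ≈⟨ ⊕-congˡ A D≈∅ ⟨
      A ⊕ (B ∖ʷ A)  ≈⟨ A⊕D≈B ⟩
      B             ∎)

  ≺ᵈ-resp : ∀ {A A′ B B′} → A ≈ A′ → B ≈ B′ → A′ ≺ᵈ B′ → A ≺ᵈ B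
  ≺ᵈ-resp {A} {A′} A≈A′ B≈B′ (D , D≉∅ , eq) =
    D , D≉∅ , ≈-trans (⊕-cong {A} {A′} {D} {D} A≈A′ ≈-refl) (≈-trans eq (≈-sym B≈B′))

  ≺⇒≺ᵈ : ∀ {A B} → _≺_ _≈_ A B → A ≺ᵈ B
  ≺⇒≺ᵈ (B′ , A′ , A′⊂B′ , B≈B′ , A≈A′) = ≺ᵈ-resp A≈A′ B≈B′ (⊂⇒≺ᵈ {A′} {B′} A′⊂B′)

  ≺ᵈ-total : ∀ A B → A ≺ᵈ B ⊎ A ≈ B ⊎ B ≺ᵈ A
  ≺ᵈ-total A B with ZP A B
  ... | tri< A≺B _ _ = inj₁ (≺⇒≺ᵈ A≺B)
  ... | tri≈ _ A≈B _ = inj₂ (inj₁ A≈B)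
  ... | tri> _ _ B≺A = inj₂ (inj₂ (≺⇒≺ᵈ B≺A))

  ≺ᵈ⇔superset : ∀ A B → A ≺ᵈ B ⇔ (∃[ B′ ] (points A ⊂ points B′ × B ≈ B′))
  ≺ᵈ⇔superset A B = mk⇔ to (λ (B′ , A⊂B′ , B≈B′) → ≺ᵈ-resp {A} {A} ≈-refl B≈B′ (⊂⇒≺ᵈ {A} {B′} A⊂B′))
    where
    to : A ≺ᵈ B → ∃[ B′ ] (points A ⊂ points B′ × B ≈ B′)
    to (D , D≉∅ , A⊕D≈B) = A ∪ʷ D′ , (inj₁ , A∪D′⊈A) , (begin
      B         ≈⟨ A⊕D≈B ⟨
      A ⊕ D     ≈⟨ ⊕-congˡ A (pad≈ D (avoidingPadding A D)) ⟨
      A ⊕ D′    ≈⟨ ⊕≈∪ A D′ (avoiding-disjoint A D) ⟩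
      A ∪ʷ D′   ∎)
      where
      D′ = pad D (avoidingPadding A D)
      -- If the union were no larger than `A`, disjointness would empty `D′`, making `D`
      -- equinumerous to `∅ʷ`.
      A∪D′⊈A : ¬ points (A ∪ʷ D′) ⊆ points A
      A∪D′⊈A A∪D′⊆A = D≉∅ (≈-trans (≈-sym (pad≈ D (avoidingPadding A D)))
        (Empty⇒≈∅ λ x x∈D′ → avoiding-disjoint A D x (A∪D′⊆A (inj₂ x∈D′) , x∈D′)))

  differenceSemiring : DifferenceSemiring (lsuc 0ℓ) ℓ
  differenceSemiring = record
    { commutativeSemiring = commutativeSemiring
    ; +-cancelʳ           = ⊕-cancelʳ
    ; +-conical           = λ {A B} → ⊕-conical {A} {B}
    ; *-nonzero           = λ {A B} → ⊙-nonzero {A} {B}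
    ; 1-nonzero           = ⟨0⟩-nonzero
    ; 1-indecomposable    = λ {A B} → ⟨0⟩-indecomposable {A} {B}
    ; total               = ≺ᵈ-total
    }

  module ℜ = Differences differenceSemiring

  ≺ᵈ-isOrdering : IsOrdering _≈_ _≺ᵈ_
  ≺ᵈ-isOrdering = record
    -- The strict total order of the differences is pulled back along `embed`.
    { isStrictTotalOrder = OrderMonomorphism.isStrictTotalOrder ℜ.embed-isOrderMonomorphism
        ℜ.⊏ᵈ-isStrictTotalOrder
    ; superset           = ≺ᵈ⇔superset
    }

  -- Uniqueness of the operations and of the order.

  ⊕-isAddition : IsAddition _≈_ _⊕_
  ⊕-isAddition = record { congruent = ⊕-cong ; union = ⊕≈∪ }

  -- Tagged copies are disjoint representatives of any two classes; `union` fixes the value on them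
  -- and congruence carries it over.
  ⊕-unique : ∀ _⊕′_ → IsAddition _≈_ _⊕′_ → ∀ A B → (A ⊕ B) ≈ (A ⊕′ B)
  ⊕-unique _⊕′_ ⊕′-isAddition A B = begin
    A ×ʷ ⟨ 0 ⟩ ∪ʷ B ×ʷ ⟨ 1 ⟩    ≈⟨ union (A ×ʷ ⟨ 0 ⟩) (B ×ʷ ⟨ 1 ⟩) (⊕-disjoint A B) ⟨
    (A ×ʷ ⟨ 0 ⟩) ⊕′ (B ×ʷ ⟨ 1 ⟩)  ≈⟨ congruent (UP A 0) (UP B 1) ⟩
    A ⊕′ B                      ∎
    where open IsAddition ⊕′-isAddition

  ⊙-isMultiplication : IsMultiplication _≈_ _⊙_
  ⊙-isMultiplication = record { congruent = ⊙-cong ; product = ⊙≈× }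

  -- As for addition, with the multipliable representatives `A` and `code B`.
  ⊙-unique : ∀ _⊙′_ → IsMultiplication _≈_ _⊙′_ → ∀ A B → (A ⊙ B) ≈ (A ⊙′ B)
  ⊙-unique _⊙′_ ⊙′-isMultiplication A B = begin
    A ×ʷ code B  ≈⟨ product A (code B) (code-multipliable A B) ⟨
    A ⊙′ code B  ≈⟨ congruent ≈-refl (code≈ B) ⟩
    A ⊙′ B       ∎
    where open IsMultiplication ⊙′-isMultiplication

  ≺ᵈ-unique : ∀ {ℓ′} (_<_ : Rel 𝕎 ℓ′) → IsOrdering _≈_ _<_ → ∀ A B → A ≺ᵈ B ⇔ (A < B)
  ≺ᵈ-unique _<_ <-isOrdering A B = mk⇔
    (Equivalence.from (superset A B) ∘ Equivalence.to (≺ᵈ⇔superset A B))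
    (Equivalence.from (≺ᵈ⇔superset A B) ∘ Equivalence.to (superset A B))
    where open IsOrdering <-isOrdering

  embed-isNonNegativePart :
    IsNonNegativePart _≈_ _⊕_ _⊙_ _≺ᵈ_ ℜ.discretelyOrderedRing ℜ.embed
  embed-isNonNegativePart = record
    { isOrderMonomorphism = ℜ.embed-isOrderMonomorphism
    ; ⊕-homo              = ℜ.embed-+-homo
    ; ⊙-homo              = ℜ.embed-*-homo
    ; image-nonNegative   = ℜ.nonNegative⇔embedded
    }

  -- Finite point sets.

  open SemiringMult (CommutativeSemiring.semiring commutativeSemiring) using ()
    renaming (_×_ to _·_)

  listed : List Tuple → 𝕎
  listed []       = ∅ʷ
  listed (x ∷ xs) = singleton x ∪ʷ listed xs

  ∈-listed⁺ : ∀ {x xs} → x ∈ˡ xs → x ∈ points (listed xs)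
  ∈-listed⁺ (here refl) = inj₁ refl
  ∈-listed⁺ (there x∈)  = inj₂ (∈-listed⁺ x∈)

  ∈-listed⁻ : ∀ {x} xs → x ∈ points (listed xs) → x ∈ˡ xs
  ∈-listed⁻ (x ∷ xs) (inj₁ refl) = here refl
  ∈-listed⁻ (x ∷ xs) (inj₂ x∈)   = there (∈-listed⁻ xs x∈)

  -- Since the entries are distinct, each union with a singleton is disjoint and adds one copy of
  -- the unit.
  listed≈ : ∀ {xs} → Unique xs → listed xs ≈ (List.length xs · ⟨ 0 ⟩)
  listed≈ []                         = ≈-refl
  listed≈ {x ∷ xs} (x∉xs ∷ unique) = begin
    singleton x ∪ʷ listed xs           ≈⟨ ⊕≈∪ (singleton x) (listed xs)
      (λ { _ (refl , x∈) → All.lookup x∉xs (∈-listed⁻ xs x∈) refl }) ⟨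
    singleton x ⊕ listed xs            ≈⟨ ⊕-cong (singleton≈⟨0⟩ _ _) (listed≈ unique) ⟩
    ⟨ 0 ⟩ ⊕ List.length xs · ⟨ 0 ⟩     ∎

  cardinality : ∀ A m → HasCardinality (points A) m → A ≈ (m · ⟨ 0 ⟩)
  cardinality A _ (xs , unique , refl , ∈⇔) = ≈-trans
    (extensional ( ∈-listed⁺ ∘ Equivalence.to (∈⇔ _)
                 , Equivalence.from (∈⇔ _) ∘ ∈-listed⁻ xs))
    (listed≈ unique)

theorem1p9 : ∀ {ℓ : Level} (_≈_ : Rel 𝕎 ℓ) → IsEquinumerosity _≈_ →
    Σ[ _⊕_ ∈ Op₂ 𝕎 ] Σ[ _⊙_ ∈ Op₂ 𝕎 ] Σ[ _<_ ∈ Rel 𝕎 (lsuc 0ℓ ⊔ ℓ) ]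
    ( (IsAddition _≈_ _⊕_
    × (∀ (_⊕′_ : Op₂ 𝕎) → IsAddition _≈_ _⊕′_ → ∀ X Y → (X ⊕ Y) ≈ (X ⊕′ Y)))
    × (IsMultiplication _≈_ _⊙_
    × (∀ (_⊙′_ : Op₂ 𝕎) → IsMultiplication _≈_ _⊙′_ → ∀ X Y → (X ⊙ Y) ≈ (X ⊙′ Y)))
    × (IsOrdering _≈_ _<_
    × (∀ (_<′_ : Rel 𝕎 (lsuc 0ℓ ⊔ ℓ)) → IsOrdering _≈_ _<′_ → ∀ X Y → (X < Y) ⇔ (X <′ Y)))
    × (Σ[ R ∈ DiscretelyOrderedRing (lsuc 0ℓ) ℓ (lsuc 0ℓ ⊔ ℓ) ]
    Σ[ ι ∈ (𝕎 → DiscretelyOrderedRing.Carrier R) ]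
    ( IsNonNegativePart _≈_ _⊕_ _⊙_ _<_ R ι
    × (Σ[ φ ∈ (ℤ → DiscretelyOrderedRing.Carrier R) ]
    ( IsPrimeSubringIdentification R φ
    × (∀ (X : 𝕎) (m : ℕ) → HasCardinality (points X) m →
    DiscretelyOrderedRing._≈_ R (ι X) (φ (+ m))))))))
theorem1p9 _≈_ isEquinumerosity =
  _⊕_ , _⊙_ , _≺ᵈ_ ,
  (⊕-isAddition , ⊕-unique) ,
  (⊙-isMultiplication , ⊙-unique) ,
  (≺ᵈ-isOrdering , ≺ᵈ-unique) ,
  ℜ.discretelyOrderedRing , ℜ.embed , embed-isNonNegativePart ,
  ℜ.fromℤ , ℜ.fromℤ-isPrimeSubringIdentification ,
  -- `ℜ.fromℤ (+ m)` is by definition the embedding of the `m`-fold sum of `⟨ 0 ⟩`.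
  λ X m |X|≡m → ℜ.embed-cong (cardinality X m |X|≡m)
  where open Equinumerosity isEquinumerosity
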